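{- There is a constant $\Delta_0$ such that every simple graph $G$ with maximum degree $\Delta\geq\Delta_0$ satisfies $$\chi''_{\sum}(G)\leq\Delta+139\,\Delta^{5/6}\ln^{1/6}\Delta;$$ in particular $\chi''_{\sum}(G)\leq(1+o(1))\Delta$.
   Context: For a simple graph $G=(V,E)$, a proper total colouring $c:V\cup E\to\{1,\dots,k\}$ is an assignment of colours to vertices and edges such that adjacent vertices get different colours, edges sharing an endpoint get different colours, and no edge gets the same colour as either of its endpoints. The weighted degree of $v$ is $s_c(v)=c(v)+\sum_{u\in N(v)}c(uv)$. The colouring is neighbour sum distinguishing if $s_c(u)\neq s_c(v)$ for every edge $uv\in E$. The total neighbour sum distinguishing number $\chi''_{\sum}(G)$ is the least $k$ for which a neighbour sum distinguishing proper total colouring of $G$ with colours in $\{1,\dots,k\}$ exists. -}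

module Defs where

open import Data.Nat using (ℕ; zero; suc; _+_; _*_; _∸_; _^_; _≤_; _⊔_; _!)
open import Data.Fin using (Fin)
open import Data.List using (List; map; foldr; allFin)
open import Data.Nat.ListAction using (sum)
open import Data.Bool using (Bool; true; false; if_then_else_)
open import Data.Product using (Σ; ∃; _×_; _,_)
open import Relation.Binary.PropositionalEquality using (_≡_; _≢_)

record Graph : Set where
  field
    n      : ℕ
    adj    : Fin n → Fin n → Bool
    sym    : ∀ u v → adj u v ≡ adj v u
    irrefl : ∀ v → adj v v ≡ false

open Graph public

Adj : (G : Graph) → Fin (n G) → Fin (n G) → Set
Adj G u v = adj G u v ≡ true

degree : (G : Graph) → Fin (n G) → ℕ
degree G v = sum (map (λ u → if adj G v u then 1 else 0) (allFin (n G)))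

maxDegree : (G : Graph) → ℕ
maxDegree G = foldr _⊔_ 0 (map (degree G) (allFin (n G)))

InRange : ℕ → ℕ → Set
InRange k c = 1 ≤ c × c ≤ k

-- A total colouring: colours of vertices, and colours of (ordered) pairs,
-- the latter only meaningful on edges and required symmetric there.
record TotalColouring (G : Graph) : Set where
  field
    vcol : Fin (n G) → ℕ
    ecol : Fin (n G) → Fin (n G) → ℕ

open TotalColouring public

weightedDegree : (G : Graph) → TotalColouring G → Fin (n G) → ℕ
weightedDegree G c v =
  vcol c v + sum (map (λ u → if adj G v u then ecol c v u else 0) (allFin (n G)))

IsProperTotal : (G : Graph) → ℕ → TotalColouring G → Set
IsProperTotal G k c =
    (∀ v → InRange k (vcol c v))
  × (∀ u v → Adj G u v → InRange k (ecol c u v))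
  × (∀ u v → Adj G u v → ecol c u v ≡ ecol c v u)
  × (∀ u v → Adj G u v → vcol c u ≢ vcol c v)
  × (∀ u v w → Adj G u v → Adj G u w → v ≢ w → ecol c u v ≢ ecol c u w)
  × (∀ u v → Adj G u v → ecol c u v ≢ vcol c u)

IsNSD : (G : Graph) → TotalColouring G → Set
IsNSD G c = ∀ u v → Adj G u v → weightedDegree G c u ≢ weightedDegree G c v

HasNSDTotal : Graph → ℕ → Set
HasNSDTotal G k = Σ (TotalColouring G) λ c → IsProperTotal G k c × IsNSD G c

-- χ''_Σ(G) ≤ k  (χ''_Σ is the least such k, so this is equivalent)
χΣ≤ : Graph → ℕ → Set
χΣ≤ G k = Σ ℕ λ j → j ≤ k × HasNSDTotal G j

-- expScaled a m = m! · Σ_{i=0}^{m} a^i / i!  (= Σ_i a^i · m!/i!, a natural number)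
expScaled : ℕ → ℕ → ℕ
expScaled a zero    = 1
expScaled a (suc m) = suc m * expScaled a m + a ^ suc m

-- ExpLe a N  ⇔  e^a ≤ N   (e^a is the supremum of its increasing partial sums)
ExpLe : ℕ → ℕ → Set
ExpLe a N = ∀ m → expScaled a m ≤ N * (m !)

-- Bound Δ k  ⇔  k ≤ Δ + 139 Δ^{5/6} (ln Δ)^{1/6}   (real inequality, Δ ≥ 1).
-- With a = (k ∸ Δ)^6 and b = 139^6 Δ^5 this is a ≤ b ln Δ ⇔ e^a ≤ Δ^b.
Bound : ℕ → ℕ → Set
Bound Δ k = ExpLe ((k ∸ Δ) ^ 6) (Δ ^ (139 ^ 6 * Δ ^ 5))

{-# OPTIONS --safe #-}
-- Let N = ⌊Δ^(1/6)⌋. A set B is built greedily so that each of its vertices has at most D ≈ N⁵ earlier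
-- neighbours in B, while each vertex of the complement A has more than D of them.
--
-- Edges are first coloured with k = Δ + D colours; with that much slack Vizing's argument needs only fans
-- of depth one and a single Kempe chain. Each a ∈ A then selects five of the k colours: its vertex colour
-- and four colours whose edges at a lead to B. The edges of the selected colours are recoloured from
-- reserved palettes, which removes all conflicts between A-vertices and edges. Cutting the k colours into
-- windows of N⁴, Rosenfeld's counting argument (each further variable multiplies the number of good
-- assignments by at least β) provides selections for which every vertex meets at most one selected edge
-- per window; as each window has its own palette, any recolouring is proper.
--
-- The four edges from a to B carry the digits of an arbitrary number below 2Δ + 2, so that the sums on A
-- can be made even and pairwise distinct along edges, greedily. Finally B is coloured greedily from a
-- further palette of 4D + 2 colours, with odd sums.
module Submission where

open import Defs hiding (sym)
open import Data.Nat
open import Data.Nat.Properties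
open import Algebra.Properties.CommutativeMonoid.Sum +-0-commutativeMonoid as Sum using ()
open import Algebra.Properties.CommutativeSemigroup *-commutativeSemigroup using (x∙yz≈y∙xz)
open import Algebra.Properties.Semiring.Sum +-*-semiring using (*-distribˡ-sum)
open import Data.Bool using (Bool; true; false; _∧_; not; if_then_else_; T)
import Data.Bool.Properties as Boolₚ
open import Data.Empty using (⊥; ⊥-elim)
open import Data.Fin as Fin using (Fin; zero; suc; toℕ; fromℕ<; combine; remQuot)
import Data.Fin.Properties as Finₚ
open import Data.List using (map; foldr; allFin; tabulate)
open import Data.List.Properties using (map-tabulate)
open import Data.Maybe using (Maybe; just; nothing; _>>=_)
open import Data.Maybe.Properties using (just-injective; ≡-dec)
open import Data.Nat.DivMod using (_/_; _%_; m%n<n; m≡m%n+[m/n]*n; m<n⇒m%n≡m; [m+kn]%n≡m%n; m<n*o⇒m/o<n)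
open import Data.Nat.ListAction using (sum)
open import Data.Nat.Tactic.RingSolver using (solve-∀)
open import Data.Product using (Σ; ∃; ∃₂; _×_; _,_; proj₁; proj₂)
open import Data.Sum using (_⊎_; inj₁; inj₂)
open import Data.Unit using (⊤; tt)
open import Data.Vec using (Vec; []; _∷_; lookup; _[_]≔_)
open import Data.Vec.Properties using (lookup∘updateAt; lookup∘updateAt′)
open import Function using (_∘_; id)
open import Level using (Level)
open import Relation.Binary.Definitions using (Tri; tri<; tri≈; tri>)
open import Relation.Binary.PropositionalEquality hiding (J)
open import Relation.Nullary
open import Relation.Unary using (Decidable)

-- The sixth root comes from a balance. Numbers up to about 2Δ are to be written with one digit of
-- weight 1 and a few of weight `X`, so `X` is of order Δ^(1/2). Windows of `W` colours number about
-- Δ/W, and one block of `X` colours for each of them costs Δ^(3/2)/W. Each variable meets of order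
-- ΔW soft conflicts, so the counting argument needs D² of order ΔW. Both costs agree at W =
-- Δ^(2/3), where they are Δ^(5/6).
--
-- Giving A new vertex colours could take about Δ of them. Its vertices therefore share the colours
-- of the edges, and the one offending edge at each vertex is moved away.
--
-- Digits sit on edges to B because changing such an edge alters only one sum in A. Its other end
-- lies in B, whose vertex colours are fixed last and enter no sum but their own.
--
-- A progression of `X` colours with difference `X` spans about Δ colours, too many to append. These
-- palettes are interleaved with the original colours as residue classes modulo `X`.

private
  variable
    ℓ ℓ′ ℓ″ : Level
    m l : ℕ

-- Sums and counting

ι : {P : Set ℓ} → Dec P → ℕ
ι (yes _) = 1
ι (no  _) = 0

ι-intro : {P : Set ℓ} (P? : Dec P) {x : ℕ} → (P → 1 ≤ x) → ι P? ≤ x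
ι-intro (yes p) f = f p
ι-intro (no  _) f = z≤n

ι-pos : {P : Set ℓ} (P? : Dec P) → P → 1 ≤ ι P?
ι-pos (yes _) _ = s≤s z≤n
ι-pos (no ¬p) p = contradiction p ¬p

ι-yes : {P : Set ℓ} (P? : Dec P) → P → ι P? ≡ 1
ι-yes (yes _) _ = refl
ι-yes (no ¬p) p = contradiction p ¬p

ι-no : {P : Set ℓ} (P? : Dec P) → ¬ P → ι P? ≡ 0
ι-no (yes p) ¬p = contradiction p ¬p
ι-no (no _)  _  = refl

ι-elim : {P : Set ℓ} (P? : Dec P) → 1 ≤ ι P? → P
ι-elim (yes p) _ = p
ι-elim (no _)  ()

ι-mono : {P : Set ℓ} {Q : Set ℓ′} (P? : Dec P) (Q? : Dec Q) → (P → Q) → ι P? ≤ ι Q?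
ι-mono P? Q? f = ι-intro P? (ι-pos Q? ∘ f)

ι-cong : {P : Set ℓ} {Q : Set ℓ′} (P? : Dec P) (Q? : Dec Q) → (P → Q) → (Q → P) → ι P? ≡ ι Q?
ι-cong P? Q? f g = ≤-antisym (ι-mono P? Q? f) (ι-mono Q? P? g)

opaque
  ∑ : (Fin l → ℕ) → ℕ
  ∑ = Sum.sum

  ∑-empty : (f : Fin 0 → ℕ) → ∑ f ≡ 0
  ∑-empty f = refl

  ∑-suc : (f : Fin (suc l) → ℕ) → ∑ f ≡ f zero + ∑ (f ∘ suc)
  ∑-suc f = refl

  ∑-cong : {f g : Fin l → ℕ} → (∀ i → f i ≡ g i) → ∑ f ≡ ∑ g
  ∑-cong = Sum.sum-cong-≗

  ∑-distrib-+ : (f g : Fin l → ℕ) → ∑ (λ i → f i + g i) ≡ ∑ f + ∑ g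
  ∑-distrib-+ = Sum.∑-distrib-+

  ∑-comm : (f : Fin m → Fin l → ℕ) → ∑ (λ i → ∑ (f i)) ≡ ∑ (λ j → ∑ λ i → f i j)
  ∑-comm = Sum.∑-comm

  ∑-scale : (x : ℕ) (f : Fin l → ℕ) → x * ∑ f ≡ ∑ (λ i → x * f i)
  ∑-scale = *-distribˡ-sum

  ∑-mono : {f g : Fin l → ℕ} → (∀ i → f i ≤ g i) → ∑ f ≤ ∑ g
  ∑-mono {zero}  _ = z≤n
  ∑-mono {suc l} h = +-mono-≤ (h zero) (∑-mono (h ∘ suc))

  term≤∑ : (f : Fin l → ℕ) (i : Fin l) → f i ≤ ∑ f
  term≤∑ f zero    = m≤m+n _ _
  term≤∑ f (suc i) = ≤-trans (term≤∑ (f ∘ suc) i) (m≤n+m _ _)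

  ∑-pos : (f : Fin l → ℕ) → 1 ≤ ∑ f → ∃ λ i → 1 ≤ f i
  ∑-pos {suc l} f h with f zero in eq
  ... | suc _ = zero , subst (1 ≤_) (sym eq) (s≤s z≤n)
  ... | zero  = let i , q = ∑-pos (f ∘ suc) h in suc i , q

  ∑-const : ∀ l c → ∑ {l} (λ _ → c) ≡ l * c
  ∑-const zero    c = refl
  ∑-const (suc l) c = cong (c +_) (∑-const l c)

∑-≤-const : (f : Fin l → ℕ) (c : ℕ) → (∀ i → f i ≤ c) → ∑ f ≤ l * c
∑-≤-const {l} f c h = ≤-trans (∑-mono h) (≤-reflexive (∑-const l c))

∑-zero : (f : Fin l → ℕ) → (∀ i → f i ≡ 0) → ∑ f ≡ 0
∑-zero {l} f h = trans (∑-cong h) (trans (∑-const l 0) (*-zeroʳ l))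

count : {P : Fin l → Set ℓ} → Decidable P → ℕ
count P? = ∑ (λ i → ι (P? i))

count-unique : {P : Fin l → Set ℓ} (P? : Decidable P) → (∀ {i j} → P i → P j → i ≡ j) → count P? ≤ 1
count-unique {zero}  P? u = ≤-trans (≤-reflexive (∑-empty _)) z≤n
count-unique {suc l} P? u = subst (_≤ 1) (sym (∑-suc λ i → ι (P? i))) bound
  where
  bound : ι (P? zero) + count (P? ∘ suc) ≤ 1
  bound with P? zero
  ... | yes p = ≤-reflexive (cong suc (∑-zero _ λ i → ι-no (P? (suc i)) λ q → contradiction (u p q) λ ()))
  ... | no  _ = count-unique (P? ∘ suc) λ x y → Finₚ.suc-injective (u x y)

count-single : (i : Fin l) → count (λ j → j Finₚ.≟ i) ≡ 1
count-single i = ≤-antisym (count-unique (Finₚ._≟ i) λ { refl refl → refl })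
  (≤-trans (ι-pos (i Finₚ.≟ i) refl) (term≤∑ (λ j → ι (j Finₚ.≟ i)) i))

count-mono : {P : Fin l → Set ℓ} {Q : Fin l → Set ℓ′} (P? : Decidable P) (Q? : Decidable Q) →
  (∀ i → P i → Q i) → count P? ≤ count Q?
count-mono P? Q? f = ∑-mono λ i → ι-mono (P? i) (Q? i) (f i)

count-injection : {P : Fin m → Set ℓ} {Q : Fin l → Set ℓ′} {R : Fin m → Fin l → Set ℓ″}
  (P? : Decidable P) (Q? : Decidable Q) (R? : ∀ i j → Dec (R i j)) →
  (∀ i → P i → ∃ λ j → Q j × R i j) → (∀ {i i′ j} → R i j → R i′ j → i ≡ i′) → count P? ≤ count Q?
count-injection P? Q? R? f inj = begin
  ∑ (λ i → ι (P? i))                          ≤⟨ ∑-mono (λ i → ι-intro (P? i) λ p → let j , x = f i p in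
                                                   ≤-trans (ι-pos (Q? j ×-dec R? i j) x) (term≤∑ (λ j → ι (Q? j ×-dec R? i j)) j)) ⟩
  ∑ (λ i → ∑ λ j → ι (Q? j ×-dec R? i j))     ≡⟨ ∑-comm (λ i j → ι (Q? j ×-dec R? i j)) ⟩
  ∑ (λ j → ∑ λ i → ι (Q? j ×-dec R? i j))     ≤⟨ ∑-mono bound ⟩
  ∑ (λ j → ι (Q? j))                          ∎
  where
  open ≤-Reasoning
  bound : ∀ j → ∑ (λ i → ι (Q? j ×-dec R? i j)) ≤ ι (Q? j)
  bound j with Q? j
  ... | yes x = ≤-trans (count-mono (λ i → yes x ×-dec R? i j) (λ i → R? i j) λ _ → proj₂) (count-unique (λ i → R? i j) inj)
  ... | no ¬x = ≤-reflexive (∑-zero (λ i → ι (no ¬x ×-dec R? i j)) λ i → refl)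

count-avoiding : {F : Fin m → Fin l → Set ℓ} (F? : ∀ j v → Dec (F j v)) →
  m ≤ count (λ j → Finₚ.all? λ v → ¬? (F? j v)) + ∑ (λ j → ∑ λ v → ι (F? j v))
count-avoiding {m} F? = begin
  m                                ≡⟨ trans (∑-const m 1) (*-identityʳ m) ⟨
  ∑ {m} (λ _ → 1)                  ≤⟨ ∑-mono step ⟩
  ∑ (λ j → ι (A? j) + s j)         ≡⟨ ∑-distrib-+ (λ j → ι (A? j)) s ⟩
  count A? + ∑ s                   ∎
  where
  open ≤-Reasoning
  A? = λ j → Finₚ.all? λ v → ¬? (F? j v)
  s  = λ j → ∑ λ v → ι (F? j v)
  step : ∀ j → 1 ≤ ι (A? j) + s j
  step j with A? j
  ... | yes _ = s≤s z≤n
  ... | no ¬a = let v , ¬¬f = Finₚ.¬∀⟶∃¬ _ _ (λ v → ¬? (F? j v)) ¬a in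
    ≤-trans (ι-pos (F? j v) (decidable-stable (F? j v) ¬¬f)) (term≤∑ (λ v → ι (F? j v)) v)

∃-avoiding : {F : Fin m → Fin l → Set ℓ} (F? : ∀ j v → Dec (F j v)) →
  ∑ (λ j → ∑ λ v → ι (F? j v)) < m → ∃ λ j → ∀ v → ¬ F j v
∃-avoiding {m} F? h =
  let j , x = ∑-pos _ (+-cancelʳ-≤ (∑ λ j → ∑ λ v → ι (F? j v)) 1 _ (≤-trans h (count-avoiding F?)))
  in j , ι-elim (Finₚ.all? λ v → ¬? (F? j v)) x

-- Sums over all assignments of k values to m variables

module _ {k : ℕ} where

  opaque
    ∑ⱽ : (Vec (Fin k) m → ℕ) → ℕ
    ∑ⱽ {m = zero}  h = h []
    ∑ⱽ {m = suc m} h = ∑ λ c → ∑ⱽ λ v → h (c ∷ v)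

    ∑ⱽ-mono : {g h : Vec (Fin k) m → ℕ} → (∀ v → g v ≤ h v) → ∑ⱽ g ≤ ∑ⱽ h
    ∑ⱽ-mono {m = zero}  le = le []
    ∑ⱽ-mono {m = suc m} le = ∑-mono λ c → ∑ⱽ-mono λ v → le (c ∷ v)

    ∑ⱽ-cong : {g h : Vec (Fin k) m → ℕ} → (∀ v → g v ≡ h v) → ∑ⱽ g ≡ ∑ⱽ h
    ∑ⱽ-cong {m = zero}  eq = eq []
    ∑ⱽ-cong {m = suc m} eq = ∑-cong λ c → ∑ⱽ-cong λ v → eq (c ∷ v)

    ∑ⱽ-distrib-+ : (g h : Vec (Fin k) m → ℕ) → ∑ⱽ (λ v → g v + h v) ≡ ∑ⱽ g + ∑ⱽ h
    ∑ⱽ-distrib-+ {m = zero}  g h = refl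
    ∑ⱽ-distrib-+ {m = suc m} g h = trans (∑-cong λ c → ∑ⱽ-distrib-+ (g ∘ (c ∷_)) (h ∘ (c ∷_))) (∑-distrib-+ _ _)

    ∑ⱽ-scale : (x : ℕ) (h : Vec (Fin k) m → ℕ) → x * ∑ⱽ h ≡ ∑ⱽ (λ v → x * h v)
    ∑ⱽ-scale {m = zero}  x h = refl
    ∑ⱽ-scale {m = suc m} x h = trans (∑-scale x _) (∑-cong λ c → ∑ⱽ-scale x (h ∘ (c ∷_)))

    ∑ⱽ-∑-comm : ∀ {l} (h : Vec (Fin k) m → Fin l → ℕ) → ∑ⱽ (λ v → ∑ (h v)) ≡ ∑ (λ i → ∑ⱽ (λ v → h v i))
    ∑ⱽ-∑-comm {m = zero}  h = refl
    ∑ⱽ-∑-comm {m = suc m} h = trans (∑-cong λ c → ∑ⱽ-∑-comm (h ∘ (c ∷_))) (∑-comm _)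

    -- Every assignment arises k times, once for each value that is overwritten at `x`.
    ∑ⱽ-resample : (x : Fin m) (h : Vec (Fin k) m → ℕ) → ∑ⱽ (λ v → ∑ λ c → h (v [ x ]≔ c)) ≡ k * ∑ⱽ h
    ∑ⱽ-resample {suc m} zero h = begin
      ∑ {k} (λ _ → ∑ⱽ λ v → ∑ λ c → h (c ∷ v))   ≡⟨ ∑-const k _ ⟩
      k * ∑ⱽ (λ v → ∑ λ c → h (c ∷ v))           ≡⟨ cong (k *_) (∑ⱽ-∑-comm λ v c → h (c ∷ v)) ⟩
      k * ∑ (λ c → ∑ⱽ λ v → h (c ∷ v))           ∎
      where open ≡-Reasoning
    ∑ⱽ-resample {suc m} (suc x) h = begin
      ∑ (λ d → ∑ⱽ λ v → ∑ λ c → h (d ∷ (v [ x ]≔ c)))  ≡⟨ ∑-cong (λ d → ∑ⱽ-resample x (h ∘ (d ∷_))) ⟩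
      ∑ (λ d → k * ∑ⱽ λ v → h (d ∷ v))                ≡⟨ ∑-scale k (λ d → ∑ⱽ λ v → h (d ∷ v)) ⟨
      k * ∑ (λ d → ∑ⱽ λ v → h (d ∷ v))                ∎
      where open ≡-Reasoning

    ∑ⱽ-pos : (h : Vec (Fin k) m → ℕ) → 1 ≤ ∑ⱽ h → ∃ λ v → 1 ≤ h v
    ∑ⱽ-pos {m = zero}  h le = [] , le
    ∑ⱽ-pos {m = suc m} h le = let c , le₁ = ∑-pos _ le
                                  v , le₂ = ∑ⱽ-pos (h ∘ (c ∷_)) le₁
                              in c ∷ v , le₂

    ∑ⱽ-pos′ : .{{_ : NonZero k}} {h : Vec (Fin k) m → ℕ} → (∀ v → 1 ≤ h v) → 1 ≤ ∑ⱽ h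
    ∑ⱽ-pos′ {m = zero}  le = le []
    ∑ⱽ-pos′ {m = suc m} le = ≤-trans (*-mono-≤ (>-nonZero⁻¹ k) (≤-refl {1})) (≤-trans (≤-reflexive (sym (∑-const k 1)))
      (∑-mono λ c → ∑ⱽ-pos′ λ v → le (c ∷ v)))

-- Rosenfeld's counting argument. Each x has γ values that respect the hard constraints with any given values of
-- the others. A value c fails softly only if some y has a value d with Soft x c y d, and by induction at most
-- a 1/β fraction of the good assignments gives y that value; as there are at most τ triples (c , y , d), adding x
-- multiplies the number of good assignments by at least γ ∸ τ / β ≥ β. All assignments are kept total, so
-- that a set S of constrained variables is compared with S ∖ x through the ratio β / k.
module Counting {m k : ℕ} .{{_ : NonZero k}}
  (Ok : Fin m → Fin k → Set) (Ok? : ∀ x c → Dec (Ok x c))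
  (Hard Soft : Fin m → Fin k → Fin m → Fin k → Set)
  (Hard? : ∀ x c y d → Dec (Hard x c y d)) (Soft? : ∀ x c y d → Dec (Soft x c y d))
  (hard-sym : ∀ {x c y d} → Hard x c y d → Hard y d x c)
  (soft-sym : ∀ {x c y d} → Soft x c y d → Soft y d x c)
  (β γ τ : ℕ) .{{_ : NonZero β}}
  (options : ∀ x (f : Fin m → Fin k) → γ ≤ count (λ c → Ok? x c ×-dec Finₚ.all? λ y → ¬? (Hard? x c y (f y))))
  (softs : ∀ x → ∑ (λ c → ∑ λ y → ∑ λ d → ι (Soft? x c y d)) ≤ τ)
  (slack : β * β + τ ≤ β * γ)
  where

  private
    VarSet = Fin m → Bool


    _∖_ : VarSet → Fin m → VarSet
    (S ∖ x) y = S y ∧ not (does (y Finₚ.≟ x))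

    ∖-elim : ∀ S x y → (S ∖ x) y ≡ true → S y ≡ true × y ≢ x
    ∖-elim S x y h with S y | y Finₚ.≟ x
    ... | true | no y≢x = refl , y≢x

    ∖-intro : ∀ S {x y} → S y ≡ true → y ≢ x → (S ∖ x) y ≡ true
    ∖-intro S {x} {y} h y≢x with S y | y Finₚ.≟ x
    ... | true | no _ = refl
    ... | true | yes y≡x = contradiction y≡x y≢x

    member? : ∀ (S : VarSet) → Decidable (λ y → S y ≡ true)
    member? S y = S y Boolₚ.≟ true

    card : VarSet → ℕ
    card S = count (member? S)

    card-∖ : ∀ S {x} → S x ≡ true → card (S ∖ x) < card S
    card-∖ S {x} x∈S = begin
      1 + card (S ∖ x)                                             ≡⟨ cong (_+ card (S ∖ x)) (count-single x) ⟨
      count (Finₚ._≟ x) + card (S ∖ x)                             ≡⟨ ∑-distrib-+ (λ y → ι (y Finₚ.≟ x)) _ ⟨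
      ∑ (λ y → ι (y Finₚ.≟ x) + ι (member? (S ∖ x) y))             ≤⟨ ∑-mono step ⟩
      card S                                                       ∎
      where
      open ≤-Reasoning
      step : ∀ y → ι (y Finₚ.≟ x) + ι (member? (S ∖ x) y) ≤ ι (member? S y)
      step y with y Finₚ.≟ x
      ... | yes refl rewrite x∈S = ≤-refl
      ... | no _     rewrite Boolₚ.∧-identityʳ (S y) = ≤-refl

    Good : VarSet → Vec (Fin k) m → Set
    Good S v = ∀ x → S x ≡ true → Ok x (lookup v x) ×
      (∀ y → S y ≡ true → x ≢ y → ¬ Hard x (lookup v x) y (lookup v y) × ¬ Soft x (lookup v x) y (lookup v y))

    opaque
      good? : ∀ S v → Dec (Good S v)
      good? S v = Finₚ.all? λ x → member? S x →-dec (Ok? x (lookup v x) ×-dec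
        Finₚ.all? λ y → member? S y →-dec (¬? (x Finₚ.≟ y) →-dec
          (¬? (Hard? x (lookup v x) y (lookup v y)) ×-dec ¬? (Soft? x (lookup v x) y (lookup v y)))))

    #good : VarSet → ℕ
    #good S = ∑ⱽ λ v → ι (good? S v)

    good-∖ : ∀ S x v → Good S v → Good (S ∖ x) v
    good-∖ S x v g y y∈ = let y∈S , _ = ∖-elim S x y y∈ in
      proj₁ (g y y∈S) , λ z z∈ → proj₂ (g y y∈S) z (proj₁ (∖-elim S x z z∈))

    agree : ∀ S (v w : Vec (Fin k) m) → (∀ x → S x ≡ true → lookup v x ≡ lookup w x) → Good S v → Good S w
    agree S v w eq g x x∈ = subst (Ok x) (eq x x∈) (proj₁ (g x x∈)) , λ y y∈ x≢y →
      subst₂ (λ c d → ¬ Hard x c y d × ¬ Soft x c y d) (eq x x∈) (eq y y∈) (proj₂ (g x x∈) y y∈ x≢y)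

    lookup-off : ∀ S x c (v : Vec (Fin k) m) y → (S ∖ x) y ≡ true → lookup (v [ x ]≔ c) y ≡ lookup v y
    lookup-off S x c v y y∈ = lookup∘updateAt′ y x (proj₂ (∖-elim S x y y∈)) v

    extend : ∀ S x v c → Good (S ∖ x) v → Ok x c → (∀ y → ¬ Hard x c y (lookup v y)) →
      (∀ y → (S ∖ x) y ≡ true → ¬ Soft x c y (lookup v y)) → Good S (v [ x ]≔ c)
    extend S x v c g ok hard soft y y∈ with y Finₚ.≟ x
    ... | yes refl rewrite lookup∘updateAt x {λ _ → c} v = ok , λ z z∈ x≢z →
      let z∈′ = ∖-intro S z∈ (x≢z ∘ sym) in
      subst (λ d → ¬ Hard x c z d × ¬ Soft x c z d) (sym (lookup-off S x c v z z∈′)) (hard z , soft z z∈′)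
    ... | no y≢x rewrite lookup-off S x c v y (∖-intro S y∈ y≢x) = proj₁ gy , other
      where
      y∈′ = ∖-intro S y∈ y≢x
      gy = g y y∈′
      other : ∀ z → S z ≡ true → y ≢ z → ¬ Hard y (lookup v y) z (lookup (v [ x ]≔ c) z) × ¬ Soft y (lookup v y) z (lookup (v [ x ]≔ c) z)
      other z z∈ y≢z with z Finₚ.≟ x
      ... | yes refl rewrite lookup∘updateAt x {λ _ → c} v = hard y ∘ hard-sym , soft y y∈′ ∘ soft-sym
      ... | no z≢x rewrite lookup-off S x c v z (∖-intro S z∈ z≢x) = proj₂ gy z (∖-intro S z∈ z≢x) y≢z

    Ratio : VarSet → Set
    Ratio S = ∀ x → S x ≡ true → β * #good (S ∖ x) ≤ k * #good S

    #goodWith : VarSet → Fin m → Fin k → ℕ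
    #goodWith S y d = ∑ⱽ λ v → ι (good? S v) * ι (lookup v y Finₚ.≟ d)

    -- Goodness for S without y ignores the value at y, so exactly a 1/k share of those assignments
    -- has value d there. `Ratio` then turns the factor 1/k relative to S without y into 1/β
    -- relative to S.
    #goodWith-≤ : ∀ S y d → S y ≡ true → Ratio S → β * #goodWith S y d ≤ #good S
    #goodWith-≤ S y d y∈S ratio = *-cancelˡ-≤ k (begin
      k * (β * #goodWith S y d)                                  ≡⟨ x∙yz≈y∙xz k β _ ⟩
      β * (k * #goodWith S y d)                                  ≤⟨ *-monoʳ-≤ β bound ⟩
      β * #good (S ∖ y)                                          ≤⟨ ratio y y∈S ⟩
      k * #good S                                                ∎)
      where
      open ≤-Reasoning
      h : Vec (Fin k) m → ℕ
      h v = ι (good? (S ∖ y) v) * ι (lookup v y Finₚ.≟ d)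
      fibre : ∀ v → ∑ (λ c → h (v [ y ]≔ c)) ≡ ι (good? (S ∖ y) v)
      fibre v = begin-equality
        ∑ (λ c → h (v [ y ]≔ c))                                  ≡⟨ ∑-cong (λ c → cong₂ _*_
             (ι-cong (good? (S ∖ y) _) (good? (S ∖ y) v)
                     (agree (S ∖ y) (v [ y ]≔ c) v (λ x x∈ → lookup-off S y c v x x∈))
                     (agree (S ∖ y) v (v [ y ]≔ c) (λ x x∈ → sym (lookup-off S y c v x x∈))))
             (cong (λ e → ι (e Finₚ.≟ d)) (lookup∘updateAt y v))) ⟩
        ∑ (λ c → ι (good? (S ∖ y) v) * ι (c Finₚ.≟ d))            ≡⟨ ∑-scale (ι (good? (S ∖ y) v)) (λ c → ι (c Finₚ.≟ d)) ⟨
        ι (good? (S ∖ y) v) * count (Finₚ._≟ d)                   ≡⟨ cong (ι (good? (S ∖ y) v) *_) (count-single d) ⟩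
        ι (good? (S ∖ y) v) * 1                                   ≡⟨ *-identityʳ _ ⟩
        ι (good? (S ∖ y) v)                                       ∎
      bound : k * #goodWith S y d ≤ #good (S ∖ y)
      bound = begin
        k * #goodWith S y d                                       ≤⟨ *-monoʳ-≤ k (∑ⱽ-mono λ v → *-monoˡ-≤ _
                                                                       (ι-mono (good? S v) (good? (S ∖ y) v) (good-∖ S y v))) ⟩
        k * ∑ⱽ h                                                  ≡⟨ ∑ⱽ-resample y h ⟨
        ∑ⱽ (λ v → ∑ λ c → h (v [ y ]≔ c))                          ≡⟨ ∑ⱽ-cong fibre ⟩
        #good (S ∖ y)                                             ∎

    ∑³ : (Fin k → Fin m → Fin k → ℕ) → ℕ
    ∑³ h = ∑ λ c → ∑ λ y → ∑ λ d → h c y d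

    ∑³-mono : {g h : Fin k → Fin m → Fin k → ℕ} → (∀ c y d → g c y d ≤ h c y d) → ∑³ g ≤ ∑³ h
    ∑³-mono le = ∑-mono λ c → ∑-mono λ y → ∑-mono λ d → le c y d

    term≤∑³ : (h : Fin k → Fin m → Fin k → ℕ) → ∀ c y d → h c y d ≤ ∑ λ y → ∑ λ d → h c y d
    term≤∑³ h c y d = ≤-trans (term≤∑ (h c y) d) (term≤∑ (λ y → ∑ (h c y)) y)

    ∑³-scale : ∀ x h → x * ∑³ h ≡ ∑³ (λ c y d → x * h c y d)
    ∑³-scale x h = trans (∑-scale x _) (∑-cong λ c → trans (∑-scale x _) (∑-cong λ y → ∑-scale x _))

    soft : VarSet → Fin m → Fin k → Fin m → Fin k → ℕ
    soft S x c y d = ι (Soft? x c y d) * ι (member? S y)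

    -- Each of the γ options c at x either yields a good assignment once written into v, or is
    -- blocked softly by some y. The factor `ι (lookup v y Finₚ.≟ d)` records the value d that y has
    -- in v, so that summing over v turns it into `#goodWith`.
    pointwise : ∀ S x v → γ * ι (good? (S ∖ x) v) ≤
      ∑ (λ c → ι (good? S (v [ x ]≔ c))) +
      ∑³ (λ c y d → soft (S ∖ x) x c y d * (ι (good? (S ∖ x) v) * ι (lookup v y Finₚ.≟ d)))
    pointwise S x v with good? (S ∖ x) v
    ... | no _ rewrite *-zeroʳ γ = z≤n
    ... | yes g = begin
      γ * 1                                         ≡⟨ *-identityʳ γ ⟩
      γ                                             ≤⟨ options x (lookup v) ⟩
      count opt?                                    ≤⟨ ∑-mono (λ c → ι-intro (opt? c) (step c)) ⟩
      ∑ (λ c → ι (good? S (v [ x ]≔ c)) + b c)      ≡⟨ ∑-distrib-+ (λ c → ι (good? S (v [ x ]≔ c))) b ⟩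
      ∑ (λ c → ι (good? S (v [ x ]≔ c))) + ∑ b      ∎
      where
      open ≤-Reasoning
      opt? = λ c → Ok? x c ×-dec Finₚ.all? λ y → ¬? (Hard? x c y (lookup v y))
      t : Fin k → Fin m → Fin k → ℕ
      t c y d = soft (S ∖ x) x c y d * (1 * ι (lookup v y Finₚ.≟ d))
      b : Fin k → ℕ
      b c = ∑ λ y → ∑ λ d → t c y d
      step : ∀ c → Ok x c × (∀ y → ¬ Hard x c y (lookup v y)) → 1 ≤ ι (good? S (v [ x ]≔ c)) + b c
      step c (ok , hard) with Finₚ.any? (λ y → Soft? x c y (lookup v y) ×-dec member? (S ∖ x) y)
      ... | yes (y , s , y∈) = ≤-trans (≤-trans (*-mono-≤ (*-mono-≤ (ι-pos (Soft? x c y (lookup v y)) s) (ι-pos (member? (S ∖ x) y) y∈))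
              (*-mono-≤ (≤-refl {1}) (ι-pos (lookup v y Finₚ.≟ lookup v y) refl))) (term≤∑³ t c y (lookup v y))) (m≤n+m _ _)
      ... | no ¬s = ≤-trans (ι-pos (good? S _) (extend S x v c g ok hard λ y y∈ s → ¬s (y , s , y∈))) (m≤m+n _ _)

    summed : ∀ S x → γ * #good (S ∖ x) ≤ k * #good S + ∑³ (λ c y d → soft (S ∖ x) x c y d * #goodWith (S ∖ x) y d)
    summed S x = begin
      γ * #good S′                                                              ≡⟨ ∑ⱽ-scale γ (λ v → ι (good? S′ v)) ⟩
      ∑ⱽ (λ v → γ * ι (good? S′ v))                                             ≤⟨ ∑ⱽ-mono (pointwise S x) ⟩
      ∑ⱽ (λ v → ∑ (λ c → ι (good? S (v [ x ]≔ c))) + ∑³ (λ c y d → soft S′ x c y d * w y d v))   ≡⟨ ∑ⱽ-distrib-+ _ _ ⟩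
      ∑ⱽ (λ v → ∑ (λ c → ι (good? S (v [ x ]≔ c)))) + ∑ⱽ (λ v → ∑³ (λ c y d → soft S′ x c y d * w y d v))
        ≡⟨ cong₂ _+_ (∑ⱽ-resample x (λ v → ι (good? S v))) exchange ⟩
      k * #good S + ∑³ (λ c y d → soft S′ x c y d * #goodWith S′ y d)           ∎
      where
      open ≤-Reasoning
      S′ = S ∖ x
      w : Fin m → Fin k → Vec (Fin k) m → ℕ
      w y d v = ι (good? S′ v) * ι (lookup v y Finₚ.≟ d)
      exchange : ∑ⱽ (λ v → ∑³ (λ c y d → soft S′ x c y d * w y d v)) ≡ ∑³ (λ c y d → soft S′ x c y d * #goodWith S′ y d)
      exchange = trans (∑ⱽ-∑-comm _) (∑-cong λ c → trans (∑ⱽ-∑-comm _) (∑-cong λ y →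
        trans (∑ⱽ-∑-comm _) (∑-cong λ d → sym (∑ⱽ-scale (soft S′ x c y d) (w y d)))))

    -- The inequality γ - τ/β ≥ β in subtraction-free form: everything is multiplied by β, and the
    -- soft losses stand on the other side as τ.
    ratio-step : ∀ S x → Ratio (S ∖ x) → β * #good (S ∖ x) ≤ k * #good S
    ratio-step S x ratio = *-cancelˡ-≤ β (+-cancelʳ-≤ (τ * #good S′) _ _ (begin
      β * (β * #good S′) + τ * #good S′                                        ≡⟨ cong (_+ τ * #good S′) (*-assoc β β _) ⟨
      β * β * #good S′ + τ * #good S′                                          ≡⟨ *-distribʳ-+ (#good S′) (β * β) τ ⟨
      (β * β + τ) * #good S′                                                   ≤⟨ *-monoˡ-≤ (#good S′) slack ⟩
      β * γ * #good S′                                                         ≡⟨ *-assoc β γ _ ⟩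
      β * (γ * #good S′)                                                       ≤⟨ *-monoʳ-≤ β (summed S x) ⟩
      β * (k * #good S + ∑³ (λ c y d → soft S′ x c y d * #goodWith S′ y d))    ≡⟨ *-distribˡ-+ β _ _ ⟩
      β * (k * #good S) + β * ∑³ (λ c y d → soft S′ x c y d * #goodWith S′ y d) ≤⟨ +-monoʳ-≤ _ bound ⟩
      β * (k * #good S) + τ * #good S′                                         ∎))
      where
      open ≤-Reasoning
      S′ = S ∖ x
      each : ∀ c y d → β * (soft S′ x c y d * #goodWith S′ y d) ≤ #good S′ * ι (Soft? x c y d)
      each c y d with Soft? x c y d | member? S′ y
      ... | no _  | _     = ≤-trans (≤-reflexive (*-zeroʳ β)) z≤n
      ... | yes _ | no _  = ≤-trans (≤-reflexive (*-zeroʳ β)) z≤n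
      ... | yes _ | yes y∈ = begin
        β * (#goodWith S′ y d + 0)       ≡⟨ cong (β *_) (+-identityʳ _) ⟩
        β * #goodWith S′ y d             ≤⟨ #goodWith-≤ S′ y d y∈ ratio ⟩
        #good S′                         ≡⟨ *-identityʳ _ ⟨
        #good S′ * 1                     ∎
      bound : β * ∑³ (λ c y d → soft S′ x c y d * #goodWith S′ y d) ≤ τ * #good S′
      bound = begin
        β * ∑³ (λ c y d → soft S′ x c y d * #goodWith S′ y d)     ≡⟨ ∑³-scale β _ ⟩
        ∑³ (λ c y d → β * (soft S′ x c y d * #goodWith S′ y d))   ≤⟨ ∑³-mono each ⟩
        ∑³ (λ c y d → #good S′ * ι (Soft? x c y d))               ≡⟨ ∑³-scale (#good S′) _ ⟨
        #good S′ * ∑³ (λ c y d → ι (Soft? x c y d))               ≤⟨ *-monoʳ-≤ (#good S′) (softs x) ⟩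
        #good S′ * τ                                              ≡⟨ *-comm _ τ ⟩
        τ * #good S′                                              ∎

    ratio-< : ∀ j S → card S < j → Ratio S
    ratio-< (suc j) S S<j x x∈ = ratio-step S x (ratio-< j (S ∖ x) (<-≤-trans (card-∖ S x∈) (≤-pred S<j)))

    good-exists : ∀ j S → card S < j → 1 ≤ #good S
    good-exists (suc j) S S<j with Finₚ.any? (member? S)
    ... | yes (x , x∈) = pos (≤-trans (*-mono-≤ (>-nonZero⁻¹ β) (good-exists j (S ∖ x) (<-≤-trans (card-∖ S x∈) (≤-pred S<j))))
                                 (ratio-< (suc j) S S<j x x∈))
      where
      pos : 1 ≤ k * #good S → 1 ≤ #good S
      pos h with #good S
      ... | suc _ = s≤s z≤n
      ... | zero = ≤-trans h (≤-reflexive (*-zeroʳ k))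
    ... | no ¬any = ∑ⱽ-pos′ λ v → ι-pos (good? S v) λ x x∈ → contradiction (x , x∈) ¬any

  solution : Σ (Fin m → Fin k) λ f → ∀ x → Ok x (f x) × (∀ y → x ≢ y → ¬ Hard x (f x) y (f y) × ¬ Soft x (f x) y (f y))
  solution =
    let v , le = ∑ⱽ-pos _ (good-exists _ (λ _ → true) ≤-refl)
        g = ι-elim (good? (λ _ → true) v) le
    in lookup v , λ x → proj₁ (g x refl) , λ y x≢y → proj₂ (g x refl) y refl x≢y

-- Adjacency and degrees as counts

sum-map-allFin : ∀ {m} (f : Fin m → ℕ) → sum (map f (allFin m)) ≡ ∑ f
sum-map-allFin f = trans (cong sum (map-tabulate id f)) (sum-tabulate f)
  where
  sum-tabulate : ∀ {m} (f : Fin m → ℕ) → sum (tabulate f) ≡ ∑ f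
  sum-tabulate {zero}  f = sym (∑-empty f)
  sum-tabulate {suc m} f = trans (cong (f zero +_) (sum-tabulate (f ∘ suc))) (sym (∑-suc f))

adj? : (G : Graph) → ∀ u v → Dec (Adj G u v)
adj? G u v = adj G u v Boolₚ.≟ true

adj-sym : (G : Graph) → ∀ {u v} → Adj G u v → Adj G v u
adj-sym G {u} {v} a = trans (Graph.sym G v u) a

adj-irrefl : (G : Graph) → ∀ {v} → ¬ Adj G v v
adj-irrefl G {v} a = case-⊥ (trans (sym a) (irrefl G v))
  where
  case-⊥ : true ≢ false
  case-⊥ ()

degree-count : (G : Graph) → ∀ v → degree G v ≡ count (adj? G v)
degree-count G v = trans (sum-map-allFin λ u → if adj G v u then 1 else 0) (∑-cong λ u → indicator (adj G v u))
  where
  indicator : ∀ b → (if b then 1 else 0) ≡ ι (b Boolₚ.≟ true)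
  indicator true  = refl
  indicator false = refl

degree≤maxDegree : (G : Graph) → ∀ v → count (adj? G v) ≤ maxDegree G
degree≤maxDegree G v = subst (_≤ maxDegree G) (degree-count G v)
  (subst (degree G v ≤_) (cong (foldr _⊔_ 0) (sym (map-tabulate id (degree G)))) (max-tabulate (degree G) v))
  where
  max-tabulate : ∀ {m} (f : Fin m → ℕ) i → f i ≤ foldr _⊔_ 0 (tabulate f)
  max-tabulate f zero    = m≤m⊔n _ _
  max-tabulate f (suc i) = ≤-trans (max-tabulate (f ∘ suc) i) (m≤n⊔m (f zero) _)

-- Edge colouring

-- nb x c is the other end of the edge of colour c at x, if there is one.
record PartialColouring (G : Graph) (k : ℕ) : Set where
  field
    nb      : Fin (n G) → Fin k → Maybe (Fin (n G))
    nb-sym  : ∀ {x c y} → nb x c ≡ just y → nb y c ≡ just x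
    nb-adj  : ∀ {x c y} → nb x c ≡ just y → Adj G x y
    nb-uniq : ∀ {x c d y} → nb x c ≡ just y → nb x d ≡ just y → c ≡ d

just≢nothing : ∀ {A : Set} {a : A} {x} → x ≡ just a → x ≢ nothing
just≢nothing refl ()

module EdgeColouring (G : Graph) (k : ℕ) where

  open PartialColouring

  private
    V = Fin (n G)

  Coloured : PartialColouring G k → V → V → Set
  Coloured s x y = ∃ λ c → nb s x c ≡ just y

  Missing : PartialColouring G k → V → Fin k → Set
  Missing s x c = nb s x c ≡ nothing

  maybe? : (a b : Maybe V) → Dec (a ≡ b)
  maybe? = ≡-dec Finₚ._≟_

  missing? : ∀ s x → Decidable (Missing s x)
  missing? s x c = maybe? (nb s x c) nothing

  coloured? : ∀ s x y → Dec (Coloured s x y)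
  coloured? s x y = Finₚ.any? λ c → maybe? (nb s x c) (just y)

  coloured-sym : ∀ s {x y} → Coloured s x y → Coloured s y x
  coloured-sym s (c , eq) = c , nb-sym s eq

  present : ∀ s x c → ¬ Missing s x c → ∃ λ y → nb s x c ≡ just y
  present s x c h with nb s x c
  ... | just y  = y , refl
  ... | nothing = contradiction refl h

  infix 4 _⊑_

  _⊑_ : PartialColouring G k → PartialColouring G k → Set
  s ⊑ t = ∀ {x y} → Coloured s x y → Coloured t x y

  many-missing : ∀ s x → k ≤ count (missing? s x) + count (adj? G x)
  many-missing s x = begin
    k                                                              ≡⟨ trans (∑-const k 1) (*-identityʳ k) ⟨
    ∑ {k} (λ _ → 1)                                                ≤⟨ ∑-mono split ⟩
    ∑ (λ c → ι (missing? s x c) + ι (¬? (missing? s x c)))         ≡⟨ ∑-distrib-+ (λ c → ι (missing? s x c)) _ ⟩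
    count (missing? s x) + count (λ c → ¬? (missing? s x c))       ≤⟨ +-monoʳ-≤ _ (count-injection (λ c → ¬? (missing? s x c)) (adj? G x)
                                                                         (λ c y → maybe? (nb s x c) (just y))
                                                                         (λ c h → let y , eq = present s x c h in y , nb-adj s eq , eq) (nb-uniq s)) ⟩
    count (missing? s x) + count (adj? G x)                        ∎
    where
    open ≤-Reasoning
    split : ∀ c → 1 ≤ ι (missing? s x c) + ι (¬? (missing? s x c))
    split c with missing? s x c
    ... | yes _ = s≤s z≤n
    ... | no  _ = s≤s z≤n

  module Add (s : PartialColouring G k) {x y : V} {c : Fin k}
    (x~y : Adj G x y) (fresh : ¬ Coloured s x y) (mx : Missing s x c) (my : Missing s y c) where

    private
      x≢y : x ≢ y
      x≢y refl = adj-irrefl G x~y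

      nb′ : V → Fin k → Maybe V
      nb′ z d with d Finₚ.≟ c | z Finₚ.≟ x | z Finₚ.≟ y
      ... | no _  | _     | _     = nb s z d
      ... | yes _ | yes _ | _     = just y
      ... | yes _ | no _  | yes _ = just x
      ... | yes _ | no _  | no _  = nb s z d

      new : ∀ {d} z {w} → d ≡ c → z ≡ x × w ≡ y ⊎ z ≡ y × w ≡ x → nb′ z d ≡ just w
      new {d} z d≡c e with d Finₚ.≟ c | z Finₚ.≟ x | z Finₚ.≟ y
      ... | no d≢c | _     | _     = contradiction d≡c d≢c
      new z _ (inj₁ (_ , refl))    | yes _ | yes _   | _     = refl
      new z _ (inj₂ (refl , _))    | yes _ | yes y≡x | _     = contradiction (sym y≡x) x≢y
      new z _ (inj₁ (refl , _))    | yes _ | no x≢x  | _     = contradiction refl x≢x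
      new z _ (inj₂ (_ , refl))    | yes _ | no _    | yes _ = refl
      new z _ (inj₂ (refl , _))    | yes _ | no _    | no y≢y = contradiction refl y≢y

      old : ∀ z d {w} → nb s z d ≡ just w → nb′ z d ≡ just w
      old z d eq with d Finₚ.≟ c | z Finₚ.≟ x | z Finₚ.≟ y
      ... | no _     | _        | _        = eq
      ... | yes refl | yes refl | _        = contradiction mx (just≢nothing eq)
      ... | yes refl | no _     | yes refl = contradiction my (just≢nothing eq)
      ... | yes _    | no _     | no _     = eq

      split : ∀ z d {w} → nb′ z d ≡ just w → (d ≡ c × (z ≡ x × w ≡ y ⊎ z ≡ y × w ≡ x)) ⊎ nb s z d ≡ just w
      split z d eq with d Finₚ.≟ c | z Finₚ.≟ x | z Finₚ.≟ y
      ... | no _  | _       | _       = inj₂ eq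
      ... | yes p | yes z≡x | _       = inj₁ (p , inj₁ (z≡x , sym (just-injective eq)))
      ... | yes p | no _    | yes z≡y = inj₁ (p , inj₂ (z≡y , sym (just-injective eq)))
      ... | yes _ | no _    | no _    = inj₂ eq

      swap : ∀ {z w : V} → z ≡ x × w ≡ y ⊎ z ≡ y × w ≡ x → w ≡ x × z ≡ y ⊎ w ≡ y × z ≡ x
      swap (inj₁ (p , q)) = inj₂ (q , p)
      swap (inj₂ (p , q)) = inj₁ (q , p)

      fresh′ : ∀ {z w d} → z ≡ x × w ≡ y ⊎ z ≡ y × w ≡ x → nb s z d ≢ just w
      fresh′ (inj₁ (refl , refl)) eq = fresh (_ , eq)
      fresh′ (inj₂ (refl , refl)) eq = fresh (_ , nb-sym s eq)

    result : PartialColouring G k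
    result .nb = nb′
    result .nb-sym {z} {d} {w} eq with split z d eq
    ... | inj₁ (d≡c , e) = new w d≡c (swap e)
    ... | inj₂ eq′       = old w d (nb-sym s eq′)
    result .nb-adj {z} {d} eq with split z d eq
    ... | inj₁ (_ , inj₁ (refl , refl)) = x~y
    ... | inj₁ (_ , inj₂ (refl , refl)) = adj-sym G x~y
    ... | inj₂ eq′                      = nb-adj s eq′
    result .nb-uniq {z} {c₁} {c₂} eq₁ eq₂ with split z c₁ eq₁ | split z c₂ eq₂
    ... | inj₁ (p , _) | inj₁ (q , _) = trans p (sym q)
    ... | inj₁ (_ , e) | inj₂ eq      = contradiction eq (fresh′ e)
    ... | inj₂ eq      | inj₁ (_ , e) = contradiction eq (fresh′ e)
    ... | inj₂ eq      | inj₂ eq′     = nb-uniq s eq eq′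

    extends : s ⊑ result
    extends {z} (d , eq) = d , old z d eq

    coloured : Coloured result x y
    coloured = c , new x refl (inj₁ (refl , refl))

    still-missing : ∀ z {d} → Missing s z d → d ≢ c → Missing result z d
    still-missing z {d} m d≢c with d Finₚ.≟ c | z Finₚ.≟ x | z Finₚ.≟ y
    ... | no _    | _ | _ = m
    ... | yes d≡c | _ | _ = contradiction d≡c d≢c

    only-new : ∀ {z w} → Coloured result z w → Coloured s z w ⊎ (z ≡ x × w ≡ y ⊎ z ≡ y × w ≡ x)
    only-new {z} (d , eq) with split z d eq
    ... | inj₁ (_ , e) = inj₂ e
    ... | inj₂ eq′     = inj₁ (d , eq′)

  module Remove (s : PartialColouring G k) {x y : V} {c : Fin k} (x-y : nb s x c ≡ just y) where

    private
      End : V → Fin k → Set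
      End z d = d ≡ c × (z ≡ x ⊎ z ≡ y)

      end? : ∀ z d → Dec (End z d)
      end? z d = (d Finₚ.≟ c) ×-dec ((z Finₚ.≟ x) ⊎-dec (z Finₚ.≟ y))

      nb′ : V → Fin k → Maybe V
      nb′ z d with end? z d
      ... | yes _ = nothing
      ... | no  _ = nb s z d

      kept : ∀ z d {w} → nb s z d ≡ just w → ¬ End z d → nb′ z d ≡ just w
      kept z d eq ¬e with end? z d
      ... | yes e = contradiction e ¬e
      ... | no  _ = eq

      split : ∀ z d {w} → nb′ z d ≡ just w → nb s z d ≡ just w × ¬ End z d
      split z d eq with end? z d
      ... | no ¬e = eq , ¬e

      end-sym : ∀ {z d w} → nb s z d ≡ just w → End w d → End z d
      end-sym eq (refl , inj₁ refl) = refl , inj₂ (just-injective (trans (sym (nb-sym s eq)) x-y))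
      end-sym eq (refl , inj₂ refl) = refl , inj₁ (just-injective (trans (sym (nb-sym s eq)) (nb-sym s x-y)))

    result : PartialColouring G k
    result .nb = nb′
    result .nb-sym {z} {d} {w} eq = let eq′ , ¬e = split z d eq in kept w d (nb-sym s eq′) (¬e ∘ end-sym eq′)
    result .nb-adj {z} {d} eq = nb-adj s (proj₁ (split z d eq))
    result .nb-uniq {z} {d} {d′} eq eq′ = nb-uniq s (proj₁ (split z d eq)) (proj₁ (split z d′ eq′))

    removed : ¬ Coloured result x y
    removed (d , eq) = let eq′ , ¬e = split x d eq in ¬e (nb-uniq s eq′ x-y , inj₁ refl)

    missing : Missing result x c
    missing with end? x c
    ... | yes _ = refl
    ... | no ¬e = contradiction (refl , inj₁ refl) ¬e

    still-missing : ∀ z {d} → Missing s z d → Missing result z d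
    still-missing z {d} m with end? z d
    ... | yes _ = refl
    ... | no  _ = m

    reduces : result ⊑ s
    reduces {z} (d , eq) = d , proj₁ (split z d eq)

    others : ∀ {z w} → Coloured s z w → Coloured result z w ⊎ (z ≡ x × w ≡ y ⊎ z ≡ y × w ≡ x)
    others {z} {w} (d , eq) with end? z d
    ... | no ¬e = inj₁ (d , kept z d eq ¬e)
    ... | yes (refl , inj₁ refl) = inj₂ (inj₁ (refl , just-injective (trans (sym eq) x-y)))
    ... | yes (refl , inj₂ refl) = inj₂ (inj₂ (refl , just-injective (trans (sym eq) (nb-sym s x-y))))

  Extension : PartialColouring G k → V → V → Set
  Extension s u v = Σ (PartialColouring G k) λ t → s ⊑ t × Coloured t u v

  -- The fan of depth one: uy loses β and receives c, which both of its ends miss. Then β is missing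
  -- at u as well as at v and can be given to uv.
  extend-shift : ∀ s {u v y β c} → Adj G u v → ¬ Coloured s u v → nb s u β ≡ just y →
    Missing s v β → Missing s u c → Missing s y c → Extension s u v
  extend-shift s {u} {v} {y} {β} {c} u~v fresh u-y mv mu my = A₂.result , up , A₂.coloured
    where
    module R = Remove s u-y
    module A₁ = Add R.result {c = c} (nb-adj s u-y) R.removed (R.still-missing u mu) (R.still-missing y my)
    β≢c : β ≢ c
    β≢c refl = just≢nothing u-y mu
    fresh₁ : ¬ Coloured A₁.result u v
    fresh₁ col with A₁.only-new col
    ... | inj₁ old = fresh (R.reduces old)
    ... | inj₂ (inj₁ (_ , refl)) = fresh (β , u-y)
    ... | inj₂ (inj₂ (_ , refl)) = adj-irrefl G u~v
    module A₂ = Add A₁.result {c = β} u~v fresh₁ (A₁.still-missing u R.missing β≢c) (A₁.still-missing v (R.still-missing v mv) β≢c)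
    up : s ⊑ A₂.result
    up col with R.others col
    ... | inj₁ old = A₂.extends (A₁.extends old)
    ... | inj₂ (inj₁ (refl , refl)) = A₂.extends A₁.coloured
    ... | inj₂ (inj₂ (refl , refl)) = A₂.extends (coloured-sym A₁.result A₁.coloured)

  module Swap (s : PartialColouring G k) (α γ : Fin k) (C : V → Set) (C? : Decidable C)
    (closed : ∀ {z c w} → C z → c ≡ α ⊎ c ≡ γ → nb s z c ≡ just w → C w) where

    sw : Fin k → Fin k
    sw d with d Finₚ.≟ α | d Finₚ.≟ γ
    ... | yes _ | _     = γ
    ... | no _  | yes _ = α
    ... | no _  | no _  = d

    sw-α : sw α ≡ γ
    sw-α with α Finₚ.≟ α | α Finₚ.≟ γ
    ... | yes _  | _ = refl
    ... | no α≢α | _ = contradiction refl α≢α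

    sw-γ : sw γ ≡ α
    sw-γ with γ Finₚ.≟ α | γ Finₚ.≟ γ
    ... | yes γ≡α | _      = γ≡α
    ... | no _    | yes _  = refl
    ... | no _    | no γ≢γ = contradiction refl γ≢γ

    sw-other : ∀ {d} → d ≢ α → d ≢ γ → sw d ≡ d
    sw-other {d} d≢α d≢γ with d Finₚ.≟ α | d Finₚ.≟ γ
    ... | yes d≡α | _       = contradiction d≡α d≢α
    ... | no _    | yes d≡γ = contradiction d≡γ d≢γ
    ... | no _    | no _    = refl

    sw-cases : ∀ d → (d ≡ α ⊎ d ≡ γ) × (sw d ≡ α ⊎ sw d ≡ γ) ⊎ sw d ≡ d
    sw-cases d with d Finₚ.≟ α | d Finₚ.≟ γ
    ... | yes d≡α | _       = inj₁ (inj₁ d≡α , inj₂ refl)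
    ... | no _    | yes d≡γ = inj₁ (inj₂ d≡γ , inj₁ refl)
    ... | no _    | no _    = inj₂ refl

    sw-sw : ∀ d → sw (sw d) ≡ d
    sw-sw d = by (d Finₚ.≟ α) (d Finₚ.≟ γ)
      where
      by : Dec (d ≡ α) → Dec (d ≡ γ) → sw (sw d) ≡ d
      by (yes refl) _        = trans (cong sw sw-α) sw-γ
      by (no _) (yes refl)   = trans (cong sw sw-γ) sw-α
      by (no p) (no q)       = trans (cong sw (sw-other p q)) (sw-other p q)

    private
      nb′ : V → Fin k → Maybe V
      nb′ z d with C? z
      ... | yes _ = nb s z (sw d)
      ... | no  _ = nb s z d

    nb-in : ∀ {z} d → C z → nb′ z d ≡ nb s z (sw d)
    nb-in {z} d z∈ with C? z
    ... | yes _ = refl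
    ... | no z∉ = contradiction z∈ z∉

    nb-out : ∀ {z} d → ¬ C z → nb′ z d ≡ nb s z d
    nb-out {z} d z∉ with C? z
    ... | yes z∈ = contradiction z∈ z∉
    ... | no _   = refl

    nb-fixed : ∀ z {d} → sw d ≡ d → nb′ z d ≡ nb s z d
    nb-fixed z fix with C? z
    ... | yes _ = cong (nb s z) fix
    ... | no  _ = refl

    private
      -- By `closed`, an edge coloured α or γ has both ends in C or neither, so its two ends see the
      -- same exchange. For any other colour nothing changes.
      symmetric : ∀ z d {w} → nb′ z d ≡ just w → nb′ w d ≡ just z
      symmetric z d {w} eq with sw-cases d
      ... | inj₂ fix = trans (nb-fixed w fix) (nb-sym s (trans (sym (nb-fixed z fix)) eq))
      ... | inj₁ (d∈ , sd∈) with C? z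
      ...   | yes z∈ = trans (nb-in d (closed z∈ sd∈ eq)) (nb-sym s eq)
      ...   | no z∉  = trans (nb-out d λ w∈ → z∉ (closed w∈ d∈ (nb-sym s eq))) (nb-sym s eq)

    result : PartialColouring G k
    result .nb = nb′
    result .nb-sym {z} {d} = symmetric z d
    result .nb-adj {z} eq with C? z
    ... | yes _ = nb-adj s eq
    ... | no  _ = nb-adj s eq
    result .nb-uniq {z} {d} {d′} eq eq′ with C? z
    ... | no  _ = nb-uniq s eq eq′
    ... | yes _ = trans (sym (sw-sw d)) (trans (cong sw (nb-uniq s eq eq′)) (sw-sw d′))

    preserves : s ⊑ result
    preserves {z} (d , eq) with C? z
    ... | yes _ = sw d , trans (cong (nb s z) (sw-sw d)) eq
    ... | no _  = d , eq

    reflects : result ⊑ s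
    reflects {z} (d , eq) with C? z
    ... | yes _ = sw d , eq
    ... | no  _ = d , eq

  -- The maximal path from u whose edges are coloured alternately γ, α, γ, …; it is a path because α is missing at u.
  module KempeChain (s : PartialColouring G k) (u : V) (α γ : Fin k) (α≢γ : α ≢ γ) (mu : Missing s u α) where

    private
      col : ℕ → Fin k
      col zero          = γ
      col (suc zero)    = α
      col (suc (suc i)) = col i

      col-cases : ∀ i → (col i ≡ γ × col (suc i) ≡ α) ⊎ (col i ≡ α × col (suc i) ≡ γ)
      col-cases zero          = inj₁ (refl , refl)
      col-cases (suc zero)    = inj₂ (refl , refl)
      col-cases (suc (suc i)) = col-cases i

      two-colours : ∀ {c} i → c ≡ α ⊎ c ≡ γ → c ≢ col i → c ≡ col (suc i)
      two-colours i c∈ c≢ with col-cases i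
      two-colours i (inj₁ refl) c≢ | inj₁ (p , q) = sym q
      two-colours i (inj₂ refl) c≢ | inj₁ (p , q) = contradiction (sym p) c≢
      two-colours i (inj₁ refl) c≢ | inj₂ (p , q) = contradiction (sym p) c≢
      two-colours i (inj₂ refl) c≢ | inj₂ (p , q) = sym q

      col∈ : ∀ i → col i ≡ α ⊎ col i ≡ γ
      col∈ i with col-cases i
      ... | inj₁ (p , _) = inj₂ p
      ... | inj₂ (p , _) = inj₁ p

      walk : ℕ → Maybe V
      walk zero    = just u
      walk (suc i) = walk i >>= λ y → nb s y (col i)

      At : ℕ → V → Set
      At i y = walk i ≡ just y

      forward : ∀ {i y z} → At i y → nb s y (col i) ≡ just z → At (suc i) z
      forward at eq rewrite at = eq

      backward : ∀ {i y} → At (suc i) y → ∃ λ z → At i z × nb s y (col i) ≡ just z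
      backward {i} eq with walk i
      ... | just z = z , refl , nb-sym s eq

      At-unique : ∀ {i y z} → At i y → At i z → y ≡ z
      At-unique p q = just-injective (trans (sym p) q)

      no-loop : ∀ {y c} → nb s y c ≢ just y
      no-loop eq = adj-irrefl G (nb-adj s eq)

      -- Consider the edge by which a return to y arrives. At the start y = u, where α is missing;
      -- so it is the γ-edge of u, and its other end, already the vertex at position 1, recurs with
      -- a gap smaller by two. Later, if it has the colour by which y was first entered, the
      -- predecessors coincide and the return happens one step earlier. Otherwise it is the edge by
      -- which y was first left, and again the gap shrinks by two. Gaps 1 and 2 are excluded by the
      -- absence of loops and by the alternation of colours.
      no-return : ∀ d i {y} → At i y → At (suc (i + d)) y → ⊥
      no-return d i at at′ with backward {i + d} at′
      no-return zero zero at at′ | z , at-z , eq with At-unique {0} at at-z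
      ... | refl = no-loop eq
      no-return (suc zero) zero at at′ | z , at-z , eq with just-injective at
      ... | refl = just≢nothing eq mu
      no-return (suc (suc d)) zero at at′ | z , at-z , eq with just-injective at | col-cases d
      ... | refl | inj₂ (p , _) = just≢nothing (trans (cong (nb s u) (sym p)) eq) mu
      ... | refl | inj₁ (p , _) = no-return d 1 (trans (cong (nb s u) (sym p)) eq) at-z
      no-return d (suc i) {y} at at′ | z , at-z , eq with backward {i} at | col i Finₚ.≟ col (suc i + d)
      ... | z′ , at-z′ , eq′ | yes same = no-return d i at-z′ (subst (At (suc (i + d))) (just-injective (trans (sym eq) (trans (cong (nb s y) (sym same)) eq′))) at-z)
      no-return zero (suc i) at at′ | z , at-z , eq | z′ , at-z′ , eq′ | no _ with At-unique {suc i} at (subst (λ j → At j z) (+-identityʳ (suc i)) at-z)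
      ... | refl = no-loop eq
      no-return (suc zero) (suc i) at at′ | z , at-z , eq | z′ , at-z′ , eq′ | no diff =
        diff (cong (col ∘ suc) (+-comm 1 i))
      no-return (suc (suc d)) (suc i) {y} at at′ | z , at-z , eq | z′ , at-z′ , eq′ | no diff =
        no-return d (suc (suc i)) (forward {suc i} at (trans (cong (nb s y) (sym next)) eq)) (subst (λ j → At j z) lemma at-z)
        where
        next : col (suc i + suc (suc d)) ≡ col (suc i)
        next = two-colours i (col∈ (suc i + suc (suc d))) (diff ∘ sym)
        lemma : suc i + suc (suc d) ≡ suc (suc (suc i) + d)
        lemma = cong suc (trans (+-suc i (suc d)) (cong suc (+-suc i d)))

      ends : ∀ i → walk i ≡ nothing → ∃₂ λ j t → At j t × nb s t (col j) ≡ nothing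
      ends (suc i) eq with walk i in eqᵢ
      ... | just t  = i , t , eqᵢ , eq
      ... | nothing = ends i eqᵢ

      end : ∃₂ λ j t → At j t × nb s t (col j) ≡ nothing
      end with Finₚ.any? {n = suc (n G)} (λ i → maybe? (walk (toℕ i)) nothing)
      ... | yes (i , eq) = ends (toℕ i) eq
      ... | no alive = contradiction (Finₚ.pigeonhole (n<1+n (n G)) (proj₁ ∘ at)) collide
        where
        at : ∀ (i : Fin (suc (n G))) → ∃ λ y → At (toℕ i) y
        at i with walk (toℕ i) in eq
        ... | just y  = y , refl
        ... | nothing = contradiction (i , eq) alive
        collide : ¬ ∃₂ λ i j → i Fin.< j × proj₁ (at i) ≡ proj₁ (at j)
        collide (i , j , i<j , eq) = no-return (toℕ j ∸ suc (toℕ i)) (toℕ i) (proj₂ (at i))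
          (subst₂ At (sym (m+[n∸m]≡n i<j)) (sym eq) (proj₂ (at j)))

      L : ℕ
      L = proj₁ end

    last : V
    last = proj₁ (proj₂ end)

    private
      at-last : At L last
      at-last = proj₁ (proj₂ (proj₂ end))

      stops : nb s last (col L) ≡ nothing
      stops = proj₂ (proj₂ (proj₂ end))

    On : V → Set
    On z = ∃ λ (j : Fin (suc L)) → At (toℕ j) z

    on? : Decidable On
    on? z = Finₚ.any? λ j → maybe? (walk (toℕ j)) (just z)

    private
      on : ∀ {j z} → j ≤ L → At j z → On z
      on {j} {z} j≤L at = fromℕ< (s≤s j≤L) , subst (λ i → At i z) (sym (Finₚ.toℕ-fromℕ< (s≤s j≤L))) at

      position : ∀ {z} → On z → ∃ λ j → j ≤ L × At j z
      position (j , at) = toℕ j , ≤-pred (Finₚ.toℕ<n j) , at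

      dead : ∀ {i} m → walk i ≡ nothing → walk (m + i) ≡ nothing
      dead zero        eq = eq
      dead {i} (suc m) eq = cong (_>>= λ y → nb s y (col (m + i))) (dead {i} m eq)

      continues : ∀ {j z} → j < L → At j z → nb s z (col j) ≢ nothing
      continues {j} {z} j<L at eq = just≢nothing at-last
        (subst (λ i → walk i ≡ nothing) (m∸n+n≡m j<L) (dead {suc j} (L ∸ suc j)
          (trans (cong (_>>= λ y → nb s y (col j)) at) eq)))

    u-on : On u
    u-on = on {0} z≤n refl

    closed : ∀ {z c w} → On z → c ≡ α ⊎ c ≡ γ → nb s z c ≡ just w → On w
    closed {z} {c} on-z c∈ eq with position on-z
    ... | j , j≤L , at with c Finₚ.≟ col j
    closed {z} on-z c∈ eq | j , j≤L , at | yes refl with m≤n⇒m<n∨m≡n j≤L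
    ... | inj₁ j<L  = on j<L (forward {j} at eq)
    ... | inj₂ refl with At-unique {j} at at-last
    ...   | refl = contradiction stops (just≢nothing eq)
    closed on-z c∈ eq | zero , j≤L , at | no c≢ with just-injective at | two-colours 0 c∈ c≢
    ... | refl | refl = contradiction mu (just≢nothing eq)
    closed {z} on-z c∈ eq | suc j , j≤L , at | no c≢ with backward {j} at | two-colours (suc j) c∈ c≢
    ... | w , at-w , eq′ | refl = subst On (just-injective (trans (sym eq′) eq)) (on (≤-trans (n≤1+n j) j≤L) at-w)

    -- Inner vertices of the chain carry edges of both colours, and u carries its γ-edge unless the
    -- chain stops at once.
    missing-γ⇒last : ∀ {z} → On z → Missing s z γ → z ≡ last
    missing-γ⇒last {z} on-z mz with position on-z
    ... | j , j≤L , at with col-cases j | m≤n⇒m<n∨m≡n j≤L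
    ... | _            | inj₂ refl = At-unique {j} at at-last
    ... | inj₁ (p , _) | inj₁ j<L  = contradiction (trans (cong (nb s z) p) mz) (continues j<L at)
    missing-γ⇒last on-z mz | zero , j≤L , at | inj₂ (p , _) | inj₁ _ = contradiction (sym p) α≢γ
    missing-γ⇒last {z} on-z mz | suc j , j≤L , at | inj₂ (_ , q) | inj₁ _ =
      let _ , _ , eq = backward {j} at in contradiction mz (just≢nothing (trans (cong (nb s z) (sym q)) eq))

  -- As y misses γ without being the end of the chain, it lies off the chain. Exchanging α and γ
  -- along the chain makes γ missing at u and leaves it missing at y, which is what `extend-shift`
  -- requires.
  extend-kempe : ∀ s {u v y β γ α} → Adj G u v → ¬ Coloured s u v → nb s u β ≡ just y → Missing s v β → Missing s y γ →
    (α≢γ : α ≢ γ) (mu : Missing s u α) → y ≢ KempeChain.last s u α γ α≢γ mu → Extension s u v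
  extend-kempe s {u} {v} {y} {β} {γ} {α} u~v fresh u-y mv my α≢γ mu y≢last =
    let t , up , col = extend-shift S.result u~v (fresh ∘ S.reflects) (trans (S.nb-fixed u fix) u-y) (trans (S.nb-fixed v fix) mv)
                         (trans (S.nb-in γ K.u-on) (trans (cong (nb s u) S.sw-γ) mu))
                         (trans (S.nb-out γ λ y-on → y≢last (K.missing-γ⇒last y-on my)) my)
    in t , up ∘ S.preserves , col
    where
    module K = KempeChain s u α γ α≢γ mu
    module S = Swap s α γ K.On K.on? K.closed
    -- u has a β-edge but no α-edge, and y has a β-edge but no γ-edge, so β is neither of the
    -- exchanged colours.
    fix : S.sw β ≡ β
    fix = S.sw-other (λ { refl → just≢nothing u-y mu }) (λ { refl → just≢nothing (nb-sym s u-y) my })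

  module _ (g : ℕ) (room : ∀ v → count (adj? G v) + g ≤ k) (k<g² : k < g * g) where

    private
      g≤missing : ∀ s x → g ≤ count (missing? s x)
      g≤missing s x = +-cancelʳ-≤ (count (adj? G x)) g _ (≤-trans (≤-reflexive (+-comm g _)) (≤-trans (room x) (many-missing s x)))

      g≥1 : 1 ≤ g
      g≥1 = n≢0⇒n>0 λ { refl → contradiction k<g² λ () }

      some-missing : ∀ s x → ∃ (Missing s x)
      some-missing s x = let c , le = ∑-pos _ (≤-trans g≥1 (g≤missing s x)) in c , ι-elim (missing? s x c) le

      -- γ is missing at the end of the β-edge at u, and β can be given to uv once that edge is recoloured.
      Candidate : PartialColouring G k → V → V → Fin k → Fin k → Set
      Candidate s u v β γ = Missing s v β × ∃ λ y → nb s u β ≡ just y × Missing s y γ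

      candidate? : ∀ s u v β γ → Dec (Candidate s u v β γ)
      candidate? s u v β γ = missing? s v β ×-dec Finₚ.any? λ y → maybe? (nb s u β) (just y) ×-dec missing? s y γ

      -- At least g colours β are missing at v. Each of them occurs at u, on an edge whose other end
      -- misses at least g colours γ. These g * g > k pairs cannot all have different second
      -- components.
      coincidence : ∀ s u v → (∀ β → Missing s v β → ¬ Missing s u β) →
        ∃ λ γ → ∃₂ λ β β′ → β ≢ β′ × Candidate s u v β γ × Candidate s u v β′ γ
      coincidence s u v disjoint with Finₚ.any? (λ γ → Finₚ.any? λ β → Finₚ.any? λ β′ →
                                        ¬? (β Finₚ.≟ β′) ×-dec candidate? s u v β γ ×-dec candidate? s u v β′ γ)
      ... | yes found = found
      ... | no none = contradiction k<g² (≤⇒≯ (begin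
        g * g                                                     ≤⟨ *-monoʳ-≤ g (g≤missing s v) ⟩
        g * count (missing? s v)                                  ≡⟨ ∑-scale g (λ β → ι (missing? s v β)) ⟩
        ∑ (λ β → g * ι (missing? s v β))                          ≤⟨ ∑-mono per-β ⟩
        ∑ (λ β → ∑ λ γ → ι (candidate? s u v β γ))                ≡⟨ ∑-comm (λ β γ → ι (candidate? s u v β γ)) ⟩
        ∑ (λ γ → count λ β → candidate? s u v β γ)                ≤⟨ ∑-≤-const _ 1 (λ γ → count-unique (λ β → candidate? s u v β γ) (unique γ)) ⟩
        k * 1                                                     ≡⟨ *-identityʳ k ⟩
        k                                                         ∎))
        where
        open ≤-Reasoning
        unique : ∀ γ {β β′} → Candidate s u v β γ → Candidate s u v β′ γ → β ≡ β′
        unique γ {β} {β′} p q with β Finₚ.≟ β′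
        ... | yes eq = eq
        ... | no neq = contradiction (γ , β , β′ , neq , p , q) none
        per-β : ∀ β → g * ι (missing? s v β) ≤ ∑ λ γ → ι (candidate? s u v β γ)
        per-β β with missing? s v β
        ... | no _  = ≤-trans (≤-reflexive (*-zeroʳ g)) z≤n
        ... | yes m = let y , eq = present s u β (disjoint β m) in begin
          g * 1                                                  ≡⟨ *-identityʳ g ⟩
          g                                                      ≤⟨ g≤missing s y ⟩
          count (missing? s y)                                   ≤⟨ count-mono (missing? s y)
                                                                      (λ γ → yes m ×-dec Finₚ.any? λ y → maybe? (nb s u β) (just y) ×-dec missing? s y γ)
                                                                      (λ γ my → m , y , eq , my) ⟩
          _                                                      ∎

      extend : ∀ s {u v} → Adj G u v → Extension s u v
      extend s {u} {v} u~v with coloured? s u v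
      ... | yes col = s , id , col
      ... | no fresh with Finₚ.any? (λ c → missing? s u c ×-dec missing? s v c)
      ... | yes (c , mu , mv) = let module A = Add s {c = c} u~v fresh mu mv in A.result , A.extends , A.coloured
      ... | no disjoint with coincidence s u v (λ β mv mu → disjoint (β , mu , mv)) | some-missing s u
      ... | γ , β , β′ , β≢β′ , (mβ , y , eq , my) , (mβ′ , y′ , eq′ , my′) | α , mα with missing? s u γ
      ...   | yes mγ = extend-shift s u~v fresh eq mβ mγ my
      -- The chain depends on u, α and γ only and has a single end. Since β and β′ differ, so do y
      -- and y′, and one of them is not that end.
      ...   | no ¬mγ with y Finₚ.≟ KempeChain.last s u α γ (λ { refl → ¬mγ mα }) mα
      ...     | no y≢ = extend-kempe s u~v fresh eq mβ my _ mα y≢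
      ...     | yes y≡ = extend-kempe s u~v fresh eq′ mβ′ my′ _ mα λ y′≡ →
                  β≢β′ (nb-uniq s eq (trans eq′ (cong just (trans y′≡ (sym y≡)))))

      empty : PartialColouring G k
      empty .nb _ _ = nothing
      empty .nb-sym ()
      empty .nb-adj ()
      empty .nb-uniq ()

      each : ∀ {m} (Q : Fin m → PartialColouring G k → Set) → (∀ i {s t} → s ⊑ t → Q i s → Q i t) →
        (∀ i s → Σ (PartialColouring G k) λ t → s ⊑ t × Q i t) → ∀ s → Σ (PartialColouring G k) λ t → s ⊑ t × ∀ i → Q i t
      each {zero}  Q mono step s = s , id , λ ()
      each {suc m} Q mono step s =
        let t , up , q = step zero s
            t′ , up′ , qs = each (Q ∘ suc) (mono ∘ suc) (step ∘ suc) t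
        in t′ , up′ ∘ up , λ { zero → mono zero {t} {t′} up′ q ; (suc i) → qs i }

      extend-if : ∀ u v s → Σ (PartialColouring G k) λ t → s ⊑ t × (Adj G u v → Coloured t u v)
      extend-if u v s with adj? G u v
      ... | yes u~v = let t , up , col = extend s u~v in t , up , λ _ → col
      ... | no ¬u~v = s , id , λ u~v → contradiction u~v ¬u~v

    edge-colouring : Σ (PartialColouring G k) λ s → ∀ u v → Adj G u v → Coloured s u v
    edge-colouring =
      let s , _ , cols = each (λ u s → ∀ v → Adj G u v → Coloured s u v) (λ u up col v u~v → up (col v u~v))
                           (λ u → each (λ v s → Adj G u v → Coloured s u v) (λ v up col u~v → up (col u~v)) (extend-if u)) empty
      in s , cols

-- Colour palettes

digits-unique : ∀ {X} .{{_ : NonZero X}} a a′ {b b′} → b < X → b′ < X → a * X + b ≡ a′ * X + b′ → a ≡ a′ × b ≡ b′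
digits-unique {X} a a′ {b} {b′} b<X b′<X eq = *-cancelʳ-≡ a a′ X (+-cancelʳ-≡ b′ _ _ (subst (λ z → a * X + z ≡ a′ * X + b′) b≡b′ eq)) , b≡b′
  where
  rem : ∀ a b → b < X → (a * X + b) % X ≡ b
  rem a b b<X = trans (cong (_% X) (+-comm (a * X) b)) (trans ([m+kn]%n≡m%n b a X) (m<n⇒m%n≡m b<X))
  b≡b′ : b ≡ b′
  b≡b′ = trans (sym (rem a b b<X)) (trans (cong (_% X) eq) (rem a′ b′ b′<X))

digits-< : ∀ {X a b m} → a < m → b < X → a * X + b < m * X
digits-< {X} {a} {b} {m} a<m b<X = begin-strict
  a * X + b   <⟨ +-monoʳ-< (a * X) b<X ⟩
  a * X + X   ≡⟨ +-comm (a * X) X ⟩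
  suc a * X   ≤⟨ *-monoˡ-≤ X a<m ⟩
  m * X       ∎
  where open ≤-Reasoning

-- Slot s₀ of a ∈ A holds the vertex colour of a, and the edge of that colour at a, if any, has to be recoloured.
-- The recoloured edges of the other slots adjust the sum at a: s₁ contributes a units digit, each top i a digit
-- of weight X.
Slot = Fin 5

pattern s₀ = zero
pattern s₁ = suc zero
pattern top i = suc (suc i)

-- Colours below C are split by their residue modulo X = 3J + Y: residues below 3J are reserved for the
-- three top slots, the others carry the colours `base c`.
module Palette (J Y k C : ℕ) .{{_ : NonZero Y}} where

  X : ℕ
  X = 3 * J + Y

  instance
    X-nonZero : NonZero X
    X-nonZero = >-nonZero (≤-trans (>-nonZero⁻¹ Y) (m≤n+m Y (3 * J)))

  base : ℕ → ℕ
  base c = (c / Y) * X + (3 * J + c % Y)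

  -- In window t the palette of a slot is an arithmetic progression in the digit d whose difference
  -- is the weight of the slot. Weight 0 needs one colour per window and weight 1 a block of X
  -- colours, all placed above C. Weight X gives the residue class of i J + t modulo X, placed below
  -- C among the classes that `base` leaves out.
  pal : Slot → ℕ → ℕ → ℕ
  pal s₀      t d = C + (J * X + t)
  pal s₁      t d = C + (t * X + d)
  pal (top i) t d = d * X + (toℕ i * J + t)

  scale : Slot → ℕ
  scale s₀      = 0
  scale s₁      = 1
  scale (top i) = X

  free : ℕ → ℕ
  free q = C + (J * X + (J + q))

  pal-linear : ∀ i t d → pal i t d ≡ pal i t 0 + scale i * d
  pal-linear s₀      t d = sym (+-identityʳ _)
  pal-linear s₁      t d = lemma C (t * X) d
    where
    lemma : ∀ a b c → a + (b + c) ≡ a + (b + 0) + (c + 0)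
    lemma = solve-∀
  pal-linear (top i) t d = lemma d X (toℕ i * J + t)
    where
    lemma : ∀ d x r → d * x + r ≡ r + x * d
    lemma = solve-∀

  module _ (base<C : ∀ c → c < k → base c < C) (X²≤C : X * X ≤ C) where

    private
      base-residue : ∀ c → 3 * J + c % Y < X
      base-residue c = +-monoʳ-< (3 * J) (m%n<n c Y)

      top-residue : ∀ (i : Fin 3) {t} → t < J → toℕ i * J + t < 3 * J
      top-residue i t<J = digits-< (Finₚ.toℕ<n i) t<J

      residue< : ∀ {r} → r < 3 * J → r < X
      residue< r< = <-≤-trans r< (m≤m+n (3 * J) Y)

      top<C : ∀ i {t d} → t < J → d < X → pal (top i) t d < C
      top<C i t<J d<X = <-≤-trans (digits-< d<X (residue< (top-residue i t<J))) X²≤C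

      apart : ∀ {a b} → a < C → a ≢ C + b
      apart {b = b} a<C refl = <⇒≱ a<C (m≤m+n C b)

    base-injective : ∀ {c c′} → base c ≡ base c′ → c ≡ c′
    base-injective {c} {c′} eq =
      let q , r = digits-unique (c / Y) (c′ / Y) (base-residue c) (base-residue c′) eq in
      trans (m≡m%n+[m/n]*n c Y) (trans (cong₂ (λ r q → r + q * Y) (+-cancelˡ-≡ (3 * J) _ _ r) q) (sym (m≡m%n+[m/n]*n c′ Y)))

    base≢pal : ∀ {c i t d} → c < k → t < J → d < X → base c ≢ pal i t d
    base≢pal {c} {s₀}    c<k t<J d<X eq = apart (base<C c c<k) eq
    base≢pal {c} {s₁}    c<k t<J d<X eq = apart (base<C c c<k) eq
    base≢pal {c} {top i} {d = d} c<k t<J d<X eq =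
      <⇒≱ (top-residue i t<J) (subst (3 * J ≤_) (proj₂ (digits-unique (c / Y) d (base-residue c) (residue< (top-residue i t<J)) eq)) (m≤m+n (3 * J) _))

    base≢free : ∀ {c q} → c < k → base c ≢ free q
    base≢free {c} c<k = apart (base<C c c<k)

    pal≢free : ∀ {i t d q} → t < J → d < X → pal i t d ≢ free q
    pal≢free {s₀}    {t} {d} {q} t<J d<X eq = <⇒≢ (≤-trans t<J (m≤m+n J q)) (+-cancelˡ-≡ (J * X) _ _ (+-cancelˡ-≡ C _ _ eq))
    pal≢free {s₁}    {t} {d} {q} t<J d<X eq = <⇒≢ (<-≤-trans (digits-< t<J d<X) (m≤m+n (J * X) (J + q))) (+-cancelˡ-≡ C _ _ eq)
    pal≢free {top i}     t<J d<X eq = apart (top<C i t<J d<X) eq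

    -- This reduces properness of the new colours to `separated`: two recoloured edges with the same
    -- new colour come from the same window, where selections do not touch.
    pal-window : ∀ i i′ {t t′ d d′} → t < J → t′ < J → d < X → d′ < X → pal i t d ≡ pal i′ t′ d′ → t ≡ t′
    pal-window s₀ s₀ t<J t′<J d<X d′<X eq = +-cancelˡ-≡ (J * X) _ _ (+-cancelˡ-≡ C _ _ eq)
    pal-window s₀ s₁ {t} t<J t′<J d<X d′<X eq =
      contradiction (sym (+-cancelˡ-≡ C _ _ eq)) (<⇒≢ (<-≤-trans (digits-< t′<J d′<X) (m≤m+n (J * X) t)))
    pal-window s₁ s₀ {t′ = t′} t<J t′<J d<X d′<X eq =
      contradiction (+-cancelˡ-≡ C _ _ eq) (<⇒≢ (<-≤-trans (digits-< t<J d<X) (m≤m+n (J * X) t′)))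
    pal-window s₁ s₁ {t} {t′} t<J t′<J d<X d′<X eq = proj₁ (digits-unique t t′ d<X d′<X (+-cancelˡ-≡ C _ _ eq))
    pal-window s₀ (top i) t<J t′<J d<X d′<X eq = contradiction (sym eq) (apart (top<C i t′<J d′<X))
    pal-window s₁ (top i) t<J t′<J d<X d′<X eq = contradiction (sym eq) (apart (top<C i t′<J d′<X))
    pal-window (top i) s₀ t<J t′<J d<X d′<X eq = contradiction eq (apart (top<C i t<J d<X))
    pal-window (top i) s₁ t<J t′<J d<X d′<X eq = contradiction eq (apart (top<C i t<J d<X))
    pal-window (top i) (top j) {d = d} {d′} t<J t′<J d<X d′<X eq =
      proj₂ (digits-unique {J} {{>-nonZero (≤-trans (s≤s z≤n) t<J)}} (toℕ i) (toℕ j) t<J t′<J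
        (proj₂ (digits-unique d d′ (residue< (top-residue i t<J)) (residue< (top-residue j t′<J)) eq)))

    base-bound : ∀ {c} Q → c < k → base c < C + (J * X + (J + Q))
    base-bound {c} Q c<k = <-≤-trans (base<C c c<k) (m≤m+n C _)

    pal-bound : ∀ i {t d} Q → t < J → d < X → pal i t d < C + (J * X + (J + Q))
    pal-bound s₀      Q t<J d<X = +-monoʳ-< C (+-monoʳ-< (J * X) (<-≤-trans t<J (m≤m+n J Q)))
    pal-bound s₁      Q t<J d<X = +-monoʳ-< C (<-≤-trans (digits-< t<J d<X) (m≤m+n (J * X) _))
    pal-bound (top i) Q t<J d<X = <-≤-trans (top<C i t<J d<X) (m≤m+n C _)

    free-bound : ∀ {q Q} → q < Q → free q < C + (J * X + (J + Q))
    free-bound q<Q = +-monoʳ-< C (+-monoʳ-< (J * X) (+-monoʳ-< J q<Q))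

  -- The quotient v / X may be as large as 3 (X - 1), so it is poured into the three top slots in
  -- turn, each of which takes at most X - 1.
  digit : ℕ → Slot → ℕ
  digit v s₀ = 0
  digit v s₁ = v % X
  digit v (suc (suc zero))             = pred X ⊓ (v / X)
  digit v (suc (suc (suc zero)))       = pred X ⊓ (v / X ∸ pred X)
  digit v (suc (suc (suc (suc zero)))) = v / X ∸ pred X ∸ pred X

  private
    predX<X : pred X < X
    predX<X = ≤-reflexive (suc-pred X)

  digit<X : ∀ {v} i → v < suc (3 * pred X) * X → digit v i < X
  digit<X s₀ _ = >-nonZero⁻¹ X
  digit<X {v} s₁ _ = m%n<n v X
  digit<X {v} (suc (suc zero)) _ = ≤-<-trans (m⊓n≤m (pred X) (v / X)) predX<X
  digit<X {v} (suc (suc (suc zero))) _ = ≤-<-trans (m⊓n≤m (pred X) (v / X ∸ pred X)) predX<X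
  digit<X {v} (suc (suc (suc (suc zero)))) v< = ≤-<-trans (begin
    v / X ∸ p ∸ p             ≤⟨ ∸-monoˡ-≤ p (∸-monoˡ-≤ p (≤-pred (m<n*o⇒m/o<n {v} {suc (3 * p)} {X} v<))) ⟩
    3 * p ∸ p ∸ p             ≡⟨ cong (_∸ p) (m+n∸m≡n p (p + (p + 0))) ⟩
    p + (p + 0) ∸ p           ≡⟨ m+n∸m≡n p (p + 0) ⟩
    p + 0                     ≡⟨ +-identityʳ p ⟩
    p                         ∎) predX<X
    where
    open ≤-Reasoning
    p = pred X

  digit-sum : ∀ v → ∑ (λ i → scale i * digit v i) ≡ v
  digit-sum v = begin
    ∑ (λ i → scale i * digit v i)    ≡⟨ expand (λ i → scale i * digit v i) ⟩
    0 + (1 * (v % X) + (X * (p ⊓ h) + (X * (p ⊓ (h ∸ p)) + X * (h ∸ p ∸ p))))   ≡⟨ lemma (v % X) X (p ⊓ h) (p ⊓ (h ∸ p)) (h ∸ p ∸ p) ⟩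
    v % X + ((p ⊓ h) + ((p ⊓ (h ∸ p)) + (h ∸ p ∸ p))) * X        ≡⟨ cong (λ z → v % X + ((p ⊓ h) + z) * X) (m⊓n+n∸m≡n p (h ∸ p)) ⟩
    v % X + ((p ⊓ h) + (h ∸ p)) * X                              ≡⟨ cong (λ z → v % X + z * X) (m⊓n+n∸m≡n p h) ⟩
    v % X + h * X                                                ≡⟨ m≡m%n+[m/n]*n v X ⟨
    v                                                            ∎
    where
    open ≡-Reasoning
    p = pred X
    h = v / X
    lemma : ∀ l x a b c → 0 + (1 * l + (x * a + (x * b + x * c))) ≡ l + (a + (b + c)) * x
    lemma = solve-∀
    expand : (f : Fin 5 → ℕ) → ∑ f ≡ f zero + (f (suc zero) + (f (suc (suc zero)) + (f (suc (suc (suc zero))) + f (suc (suc (suc (suc zero)))))))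
    expand f = trans (∑-suc f) (cong (f zero +_) (trans (∑-suc _) (cong (f (suc zero) +_) (trans (∑-suc _) (cong (f (suc (suc zero)) +_)
      (trans (∑-suc _) (cong (f (suc (suc (suc zero))) +_) (trans (∑-suc _) (trans (cong (f (suc (suc (suc (suc zero)))) +_) (∑-empty _)) (+-identityʳ _))))))))))

-- Greedy choices

-- The quantifier over f′ expresses that the choice at v stays valid however later values are filled
-- in: only agreement before v and the value at v are assumed.
greedy : ∀ {m} {A : Set} → A → (P : Fin m → (Fin m → A) → Set) →
  (∀ v (f : Fin m → A) → ∃ λ a → ∀ f′ → (∀ u → u Fin.< v → f′ u ≡ f u) → f′ v ≡ a → P v f′) →
  ∃ λ f → ∀ v → P v f
greedy {m} {A} a₀ P choose = let f , h = build m ≤-refl in f , λ v → h v (Finₚ.toℕ<n v) f (λ _ _ → refl)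
  where
  build : ∀ i → i ≤ m → ∃ λ (f : Fin m → A) → ∀ v → toℕ v < i → ∀ f′ → (∀ u → toℕ u < i → f′ u ≡ f u) → P v f′
  build zero    _   = (λ _ → a₀) , λ _ ()
  build (suc i) i<m = f′ , good
    where
    f = proj₁ (build i (<⇒≤ i<m))
    w = fromℕ< i<m
    w≡i : toℕ w ≡ i
    w≡i = Finₚ.toℕ-fromℕ< i<m
    a = proj₁ (choose w f)
    f′ : Fin m → A
    f′ u = if does (u Finₚ.≟ w) then a else f u
    f′-w : ∀ {u} → u ≡ w → f′ u ≡ a
    f′-w {u} u≡w with u Finₚ.≟ w
    ... | yes _  = refl
    ... | no u≢w = contradiction u≡w u≢w
    f′-other : ∀ {u} → toℕ u < i → f′ u ≡ f u
    f′-other {u} u<i with u Finₚ.≟ w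
    ... | yes refl = contradiction u<i (<-irrefl w≡i)
    ... | no _     = refl
    good : ∀ v → toℕ v < suc i → ∀ f″ → (∀ u → toℕ u < suc i → f″ u ≡ f′ u) → P v f″
    good v v<1+i f″ agree with m≤n⇒m<n∨m≡n (≤-pred v<1+i)
    ... | inj₁ v<i = proj₂ (build i (<⇒≤ i<m)) v v<i f″ λ u u<i → trans (agree u (m<n⇒m<1+n u<i)) (f′-other u<i)
    ... | inj₂ v≡i with Finₚ.toℕ-injective {i = v} {w} (trans v≡i (sym w≡i))
    ...   | refl = proj₂ (choose w f) f″ (λ u u<w → let u<i = subst (toℕ u <_) w≡i u<w in
                     trans (agree u (m<n⇒m<1+n u<i)) (f′-other u<i)) (trans (agree w v<1+i) (f′-w refl))

-- Each earlier neighbour excludes at most one shift for each of the r quantities, hence at most M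
-- of the M + 1 shifts in all.
greedy-shifts : ∀ {m r} {R : Fin m → Fin m → Set} (R? : ∀ v u → Dec (R v u)) (h : Fin r → Fin m → ℕ) (M : ℕ) →
  (∀ {v u} → R v u → R u v) → (∀ {v} → ¬ R v v) → (∀ v → r * count (λ u → (u Finₚ.<? v) ×-dec R? v u) ≤ M) →
  ∃ λ (f : Fin m → Fin (suc M)) → ∀ {v u} → R v u → ∀ i → h i v + toℕ (f v) ≢ h i u + toℕ (f u)
greedy-shifts {m} {r} {R} R? h M R-sym R-irrefl few = f , λ {v} {u} → by v u (Finₚ.<-cmp u v)
  where
  Earlier : Fin m → Fin m → Set
  Earlier v u = u Fin.< v × R v u
  earlier? : ∀ v u → Dec (Earlier v u)
  earlier? v u = (u Finₚ.<? v) ×-dec R? v u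
  Clash : Fin m → (Fin m → Fin (suc M)) → Fin (suc M) → Fin m → Set
  Clash v f j u = Earlier v u × ∃ λ i → h i v + toℕ j ≡ h i u + toℕ (f u)
  clash? : ∀ v f j u → Dec (Clash v f j u)
  clash? v f j u = earlier? v u ×-dec Finₚ.any? λ i → (h i v + toℕ j) ≟ (h i u + toℕ (f u))
  per-u : ∀ v f u → ∑ (λ j → ι (clash? v f j u)) ≤ r * ι (earlier? v u)
  per-u v f u with earlier? v u
  ... | no ¬e = ≤-trans (≤-reflexive (∑-zero (λ j → ι (no ¬e ×-dec Finₚ.any? λ i → (h i v + toℕ j) ≟ (h i u + toℕ (f u)))) λ _ → refl)) z≤n
  ... | yes e = begin
    ∑ (λ j → ι (yes e ×-dec any j))    ≤⟨ ∑-mono (λ j → ι-intro (yes e ×-dec any j) λ { (_ , i , eq) →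
                                            ≤-trans (ι-pos (meets? j i) eq) (term≤∑ (λ i → ι (meets? j i)) i) }) ⟩
    ∑ (λ j → ∑ λ i → ι (meets? j i))      ≡⟨ ∑-comm (λ j i → ι (meets? j i)) ⟩
    ∑ (λ i → count λ j → meets? j i)      ≤⟨ ∑-≤-const _ 1 (λ i → count-unique (λ j → meets? j i)
                                            λ p q → Finₚ.toℕ-injective (+-cancelˡ-≡ (h i v) _ _ (trans p (sym q)))) ⟩
    r * 1                              ∎
    where
    open ≤-Reasoning
    meets? : ∀ j i → Dec (h i v + toℕ j ≡ h i u + toℕ (f u))
    meets? j i = (h i v + toℕ j) ≟ (h i u + toℕ (f u))
    any : ∀ (j : Fin (suc M)) → Dec (∃ λ i → h i v + toℕ j ≡ h i u + toℕ (f u))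
    any j = Finₚ.any? (meets? j)
  chosen : ∃ λ (f : Fin m → Fin (suc M)) → ∀ v u → u Fin.< v → R v u → ∀ i → h i v + toℕ (f v) ≢ h i u + toℕ (f u)
  chosen = greedy zero _ λ v f →
    let F? = clash? v f
        a , free = ∃-avoiding F? (s≤s (≤-trans (≤-reflexive (∑-comm λ j u → ι (F? j u)))
                     (≤-trans (∑-mono (per-u v f)) (≤-trans (≤-reflexive (sym (∑-scale r _))) (few v)))))
    in a , λ f′ agree f′v≡a u u<v rvu i eq → free u ((u<v , rvu) , i , subst₂ (λ a b → h i v + toℕ a ≡ h i u + toℕ b) f′v≡a (agree u u<v) eq)
  f = proj₁ chosen
  by : ∀ v u → Tri (u Fin.< v) (u ≡ v) (v Fin.< u) → R v u → ∀ i → h i v + toℕ (f v) ≢ h i u + toℕ (f u)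
  by v u (tri< u<v _ _)  rvu i    = proj₂ chosen v u u<v rvu i
  by v u (tri≈ _ refl _) rvu i _  = R-irrefl rvu
  by v u (tri> _ _ v<u)  rvu i eq = proj₂ chosen u v v<u (R-sym rvu) i (sym eq)

degenerate-set : (G : Graph) (D : ℕ) → ∃ λ (f : Fin (n G) → Bool) →
  (∀ v → f v ≡ true  → count (λ u → (u Finₚ.<? v) ×-dec adj? G v u ×-dec (f u Boolₚ.≟ true)) ≤ D) ×
  (∀ v → f v ≡ false → D < count (λ u → (u Finₚ.<? v) ×-dec adj? G v u ×-dec (f u Boolₚ.≟ true)))
degenerate-set G D =
  let f , h = greedy false P choose in f , proj₁ ∘ h , proj₂ ∘ h
  where
  back? : ∀ (f : Fin (n G) → Bool) v → Decidable (λ u → u Fin.< v × Adj G v u × f u ≡ true)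
  back? f v u = (u Finₚ.<? v) ×-dec adj? G v u ×-dec (f u Boolₚ.≟ true)
  P : Fin (n G) → (Fin (n G) → Bool) → Set
  P v f = (f v ≡ true → count (back? f v) ≤ D) × (f v ≡ false → D < count (back? f v))
  count-≡ : ∀ {f f′} v → (∀ u → u Fin.< v → f′ u ≡ f u) → count (back? f v) ≡ count (back? f′ v)
  count-≡ {f} {f′} v agree = ∑-cong λ u → ι-cong (back? f v u) (back? f′ v u)
    (λ { (lt , a , e) → lt , a , trans (agree u lt) e }) (λ { (lt , a , e) → lt , a , trans (sym (agree u lt)) e })
  choose : ∀ v f → ∃ λ a → ∀ f′ → (∀ u → u Fin.< v → f′ u ≡ f u) → f′ v ≡ a → P v f′
  choose v f with count (back? f v) ≤? D
  ... | yes le = true , λ f′ agree eq → (λ _ → subst (_≤ D) (count-≡ v agree) le) , λ eq′ → contradiction (trans (sym eq) eq′) λ ()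
  ... | no ≰   = false , λ f′ agree eq → (λ eq′ → contradiction (trans (sym eq) eq′) λ ()) , λ _ → subst (D <_) (count-≡ v agree) (≰⇒> ≰)

count-all : ∀ {m} {P : Fin m → Set} (P? : Decidable P) → (∀ i → P i) → count P? ≡ m
count-all {m} P? all = trans (∑-cong λ i → ι-yes (P? i) (all i)) (trans (∑-const m 1) (*-identityʳ m))

count-window : ∀ k W t .{{_ : NonZero W}} → count {l = k} (λ c → (toℕ c / W) ≟ t) ≤ W
count-window k W t = ≤-trans
  (count-injection {l = W} {Q = λ _ → ⊤} (λ c → (toℕ c / W) ≟ t) (λ _ → yes tt) (λ c r → ((toℕ c / W) ≟ t) ×-dec ((toℕ c % W) ≟ toℕ r))
    (λ c eq → fromℕ< (m%n<n (toℕ c) W) , tt , eq , sym (Finₚ.toℕ-fromℕ< (m%n<n (toℕ c) W)))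
    (λ { {c} {c′} (q , r) (q′ , r′) → Finₚ.toℕ-injective (trans (m≡m%n+[m/n]*n (toℕ c) W)
      (trans (cong₂ (λ a b → a + b * W) (trans r (sym r′)) (trans q (sym q′))) (sym (m≡m%n+[m/n]*n (toℕ c′) W)))) }))
  (≤-reflexive (count-all {P = λ _ → ⊤} (λ _ → yes tt) λ _ → tt))

-- Selected colours

module Owned (G : Graph) (k W : ℕ) .{{_ : NonZero W}} (s : PartialColouring G k) (inB : Fin (n G) → Bool) where

  open PartialColouring s

  private
    V = Fin (n G)

  A B : V → Set
  A v = inB v ≡ false
  B v = inB v ≡ true

  a? : Decidable A
  a? v = inB v Boolₚ.≟ false

  b? : Decidable B
  b? v = inB v Boolₚ.≟ true

  window : Fin k → ℕ
  window c = toℕ c / W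

  -- The ends of the c-edge at a include a even if there is no such edge, and likewise for the d-edge at b.
  Touch : V → Fin k → V → Fin k → Set
  Touch a c b d = a ≡ b ⊎ nb a c ≡ just b ⊎ nb b d ≡ just a ⊎ ∃ λ w → nb a c ≡ just w × nb b d ≡ just w

  -- `separated` with a = b places the five slots of a in different windows, so their colours differ
  -- too. With a ≢ b it forbids two selected edges of one window to meet.
  record Choice : Set where
    field
      F         : V → Slot → Fin k
      to-B      : ∀ {a i} → A a → i ≢ s₀ → ∃ λ b → nb a (F a i) ≡ just b × B b
      proper    : ∀ {a b} → A a → A b → Adj G a b → F a s₀ ≢ F b s₀
      separated : ∀ {a i b j} → A a → A b → a ≢ b ⊎ i ≢ j → window (F b j) ≡ window (F a i) → ¬ Touch a (F a i) b (F b j)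

module Selection (G : Graph) (Δ k W D β γ : ℕ) .{{_ : NonZero W}} .{{_ : NonZero k}} .{{_ : NonZero β}}
  (degree≤Δ : ∀ v → count (adj? G v) ≤ Δ)
  (s : PartialColouring G k) (total : ∀ u v → Adj G u v → EdgeColouring.Coloured G k s u v)
  (inB : Fin (n G) → Bool)
  (many-B : ∀ v → inB v ≡ false → D < count (λ u → (u Finₚ.<? v) ×-dec adj? G v u ×-dec (inB u Boolₚ.≟ true)))
  (Δ+γ≤k : Δ + γ ≤ k) (γ≤1+D : γ ≤ suc D) (slack : β * β + k * (W * 20) ≤ β * γ)
  where

  open PartialColouring s
  open EdgeColouring G k using (maybe?)

  private
    V   = Fin (n G)
    Var = Fin (n G * 5)

  open Owned G k W s inB

  private
    owner : Var → V
    owner x = proj₁ (remQuot {n G} 5 x)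

    slot : Var → Slot
    slot x = proj₂ (remQuot {n G} 5 x)

    var-injective : ∀ {x y} → owner x ≡ owner y → slot x ≡ slot y → x ≡ y
    var-injective {x} {y} p q = trans (sym (Finₚ.combine-remQuot {n G} 5 x)) (trans (cong₂ combine p q) (Finₚ.combine-remQuot {n G} 5 y))

    touch? : ∀ a c b d → Dec (Touch a c b d)
    touch? a c b d = (a Finₚ.≟ b) ⊎-dec maybe? (nb a c) (just b) ⊎-dec maybe? (nb b d) (just a) ⊎-dec
      Finₚ.any? λ w → maybe? (nb a c) (just w) ×-dec maybe? (nb b d) (just w)

    touch-sym : ∀ {a c b d} → Touch a c b d → Touch b d a c
    touch-sym (inj₁ refl)                        = inj₁ refl
    touch-sym (inj₂ (inj₁ eq))                   = inj₂ (inj₂ (inj₁ eq))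
    touch-sym (inj₂ (inj₂ (inj₁ eq)))            = inj₂ (inj₁ eq)
    touch-sym (inj₂ (inj₂ (inj₂ (w , p , q))))   = inj₂ (inj₂ (inj₂ (w , q , p)))

    Ok : Var → Fin k → Set
    Ok x c = A (owner x) → slot x ≢ s₀ → ∃ λ b → nb (owner x) c ≡ just b × B b

    ok? : ∀ x c → Dec (Ok x c)
    ok? x c = a? (owner x) →-dec (¬? (slot x Finₚ.≟ s₀) →-dec Finₚ.any? λ b → maybe? (nb (owner x) c) (just b) ×-dec b? b)

    -- Equal colours on adjacent vertices of A exclude at most Δ colours, whatever the other values
    -- are, and can be hard. Touching within a window has no such worst-case bound and is controlled
    -- only on average, hence soft.
    Hard Soft : Var → Fin k → Var → Fin k → Set
    Hard x c y d = (A (owner x) × A (owner y)) × (slot x ≡ s₀ × slot y ≡ s₀) × Adj G (owner x) (owner y) × c ≡ d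
    Soft x c y d = (A (owner x) × A (owner y)) × window d ≡ window c × Touch (owner x) c (owner y) d

    hard? : ∀ x c y d → Dec (Hard x c y d)
    hard? x c y d = (a? (owner x) ×-dec a? (owner y)) ×-dec ((slot x Finₚ.≟ s₀) ×-dec (slot y Finₚ.≟ s₀)) ×-dec
      adj? G (owner x) (owner y) ×-dec (c Finₚ.≟ d)

    soft? : ∀ x c y d → Dec (Soft x c y d)
    soft? x c y d = (a? (owner x) ×-dec a? (owner y)) ×-dec (window d ≟ window c) ×-dec touch? (owner x) c (owner y) d

    hard-sym : ∀ {x c y d} → Hard x c y d → Hard y d x c
    hard-sym ((a , a′) , (z , z′) , x~y , eq) = (a′ , a) , (z′ , z) , adj-sym G x~y , sym eq

    soft-sym : ∀ {x c y d} → Soft x c y d → Soft y d x c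
    soft-sym ((a , a′) , w , t) = (a′ , a) , sym w , touch-sym t

    count-owner : ∀ {P : V → Set} (P? : Decidable P) → (∀ {a b} → P a → P b → a ≡ b) → count (λ y → P? (owner y)) ≤ 5
    count-owner {P} P? unique = ≤-trans
      (count-injection {l = 5} {Q = λ _ → ⊤} (λ y → P? (owner y)) (λ _ → yes tt) (λ y i → P? (owner y) ×-dec (slot y Finₚ.≟ i))
        (λ y p → slot y , tt , p , refl) (λ { (p , refl) (q , eq) → var-injective (unique p q) (sym eq) }))
      (≤-reflexive (count-all {P = λ _ → ⊤} (λ _ → yes tt) λ _ → tt))

    -- 20 = 4 ways to touch × 5 slots
    count-touch : ∀ a c d → count (λ y → touch? a c (owner y) d) ≤ 20
    count-touch a c d = begin
      count (λ y → touch? a c (owner y) d)                                   ≤⟨ ∑-mono (λ y → ι-intro (touch? a c (owner y) d) (cases (owner y))) ⟩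
      ∑ (λ y → (ι (p₁ (owner y)) + ι (p₂ (owner y))) + (ι (p₃ (owner y)) + ι (p₄ (owner y))))
        ≡⟨ trans (∑-distrib-+ _ _) (cong₂ _+_ (∑-distrib-+ _ _) (∑-distrib-+ _ _)) ⟩
      (count (p₁ ∘ owner) + count (p₂ ∘ owner)) + (count (p₃ ∘ owner) + count (p₄ ∘ owner))
        ≤⟨ +-mono-≤ (+-mono-≤ (count-owner p₁ λ { refl refl → refl }) (count-owner p₂ λ p q → just-injective (trans (sym p) q)))
                    (+-mono-≤ (count-owner p₃ λ p q → just-injective (trans (sym (nb-sym p)) (nb-sym q))) (count-owner p₄ unique₄)) ⟩
      20                                                                     ∎
      where
      open ≤-Reasoning
      p₁ : ∀ b → Dec (a ≡ b)
      p₁ b = a Finₚ.≟ b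
      p₂ : ∀ b → Dec (nb a c ≡ just b)
      p₂ b = maybe? (nb a c) (just b)
      p₃ : ∀ b → Dec (nb b d ≡ just a)
      p₃ b = maybe? (nb b d) (just a)
      p₄ : ∀ b → Dec (∃ λ w → nb a c ≡ just w × nb b d ≡ just w)
      p₄ b = Finₚ.any? λ w → maybe? (nb a c) (just w) ×-dec maybe? (nb b d) (just w)
      unique₄ : ∀ {b b′} → (∃ λ w → nb a c ≡ just w × nb b d ≡ just w) → (∃ λ w → nb a c ≡ just w × nb b′ d ≡ just w) → b ≡ b′
      unique₄ (w , p , q) (w′ , p′ , q′) with just-injective (trans (sym p) p′)
      ... | refl = just-injective (trans (sym (nb-sym q)) (nb-sym q′))
      cases : ∀ b → Touch a c b d → 1 ≤ (ι (p₁ b) + ι (p₂ b)) + (ι (p₃ b) + ι (p₄ b))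
      cases b (inj₁ t)               = ≤-trans (ι-pos (p₁ b) t) (≤-trans (m≤m+n _ _) (m≤m+n _ _))
      cases b (inj₂ (inj₁ t))        = ≤-trans (ι-pos (p₂ b) t) (≤-trans (m≤n+m _ (ι (p₁ b))) (m≤m+n _ _))
      cases b (inj₂ (inj₂ (inj₁ t))) = ≤-trans (ι-pos (p₃ b) t) (≤-trans (m≤m+n _ _) (m≤n+m _ (ι (p₁ b) + ι (p₂ b))))
      cases b (inj₂ (inj₂ (inj₂ t))) = ≤-trans (ι-pos (p₄ b) t) (≤-trans (m≤n+m _ (ι (p₃ b))) (m≤n+m _ (ι (p₁ b) + ι (p₂ b))))

    softs : ∀ x → ∑ (λ c → ∑ λ y → ∑ λ d → ι (soft? x c y d)) ≤ k * (W * 20)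
    softs x = ∑-≤-const _ (W * 20) λ c → begin
      ∑ (λ y → ∑ λ d → ι (soft? x c y d))               ≡⟨ ∑-comm (λ y d → ι (soft? x c y d)) ⟩
      ∑ (λ d → ∑ λ y → ι (soft? x c y d))               ≤⟨ ∑-mono (per-d c) ⟩
      ∑ (λ d → 20 * ι (window d ≟ window c))            ≡⟨ ∑-scale 20 _ ⟨
      20 * count (λ d → window d ≟ window c)            ≤⟨ *-monoʳ-≤ 20 (count-window k W (window c)) ⟩
      20 * W                                            ≡⟨ *-comm 20 W ⟩
      W * 20                                            ∎
      where
      open ≤-Reasoning
      per-d : ∀ c d → ∑ (λ y → ι (soft? x c y d)) ≤ 20 * ι (window d ≟ window c)
      per-d c d = by (window d ≟ window c)
        where
        by : (w? : Dec (window d ≡ window c)) → ∑ (λ y → ι (soft? x c y d)) ≤ 20 * ι w?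
        by (no w≢)  = ≤-trans (≤-reflexive (∑-zero _ λ y → ι-no (soft? x c y d) λ { (_ , w≡ , _) → w≢ w≡ })) z≤n
        by (yes _)  = ≤-trans (count-mono (λ y → soft? x c y d) (λ y → touch? (owner x) c (owner y) d) λ _ → proj₂ ∘ proj₂) (count-touch (owner x) c d)

    -- Slot `s₀` must avoid one colour for each of at most Δ neighbours, and k - Δ ≥ γ colours
    -- remain. The other slots have no hard constraint; the more than D edges from a vertex of A to
    -- B have different colours, each of them an option.
    options : ∀ x (f : Var → Fin k) → γ ≤ count (λ c → ok? x c ×-dec Finₚ.all? λ y → ¬? (hard? x c y (f y)))
    options x f = by (a? (owner x)) (slot x Finₚ.≟ s₀)
      where
      open ≤-Reasoning
      free? = λ c → Finₚ.all? λ y → ¬? (hard? x c y (f y))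
      opt?  = λ c → ok? x c ×-dec free? c
      back? = λ u → (u Finₚ.<? owner x) ×-dec adj? G (owner x) u ×-dec (inB u Boolₚ.≟ true)
      near? : ∀ y → Dec (slot y ≡ s₀ × Adj G (owner x) (owner y))
      near? y = (slot y Finₚ.≟ s₀) ×-dec adj? G (owner x) (owner y)
      per-y : ∀ y (d : Dec (slot y ≡ s₀ × Adj G (owner x) (owner y))) → ∑ (λ c → ι (hard? x c y (f y))) ≤ ι d
      per-y y (yes _) = count-unique (λ c → hard? x c y (f y)) λ { (_ , _ , _ , p) (_ , _ , _ , q) → trans p (sym q) }
      per-y y (no ¬p) = ≤-reflexive (∑-zero _ λ c → ι-no (hard? x c y (f y)) λ { (_ , (_ , z) , a , _) → ¬p (z , a) })
      few : ∑ (λ c → ∑ λ y → ι (hard? x c y (f y))) ≤ Δ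
      few = begin
        ∑ (λ c → ∑ λ y → ι (hard? x c y (f y)))    ≡⟨ ∑-comm (λ c y → ι (hard? x c y (f y))) ⟩
        ∑ (λ y → ∑ λ c → ι (hard? x c y (f y)))    ≤⟨ ∑-mono (λ y → per-y y (near? y)) ⟩
        count near?                                ≤⟨ count-injection near? (adj? G (owner x)) (λ y b → (slot y Finₚ.≟ s₀) ×-dec (owner y Finₚ.≟ b))
                                                        (λ { y (z , a) → owner y , a , z , refl }) (λ { (z , refl) (z′ , eq) → var-injective (sym eq) (trans z (sym z′)) }) ⟩
        count (adj? G (owner x))                   ≤⟨ degree≤Δ (owner x) ⟩
        Δ                                          ∎
      by : Dec (A (owner x)) → Dec (slot x ≡ s₀) → γ ≤ count opt?
      by (no x∉A) _ = begin
        γ                              ≤⟨ ≤-trans (m≤n+m γ Δ) Δ+γ≤k ⟩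
        k                              ≡⟨ count-all {P = λ _ → ⊤} (λ _ → yes tt) (λ _ → tt) ⟨
        count {l = k} (λ _ → yes tt)   ≤⟨ count-mono (λ _ → yes tt) opt?
                                            (λ c _ → (λ a → contradiction a x∉A) , λ { y ((a , _) , _) → x∉A a }) ⟩
        count opt?                     ∎
      by (yes _) (yes x≡0) = +-cancelˡ-≤ Δ γ _ (begin
        Δ + γ                                                                ≤⟨ Δ+γ≤k ⟩
        k                                                                    ≤⟨ count-avoiding (λ c y → hard? x c y (f y)) ⟩
        count free? + ∑ (λ c → ∑ λ y → ι (hard? x c y (f y)))                ≤⟨ +-mono-≤ (count-mono free? opt? λ c h → (λ _ x≢0 → contradiction x≡0 x≢0) , h) few ⟩
        count opt? + Δ                                                       ≡⟨ +-comm _ Δ ⟩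
        Δ + count opt?                                                       ∎)
      by (yes x∈A) (no x≢0) = begin
        γ             ≤⟨ γ≤1+D ⟩
        suc D         ≤⟨ many-B (owner x) x∈A ⟩
        count back?   ≤⟨ count-injection back? opt? (λ u c → maybe? (nb (owner x) c) (just u))
                           (λ { u (_ , x~u , u∈B) → let c , e = total (owner x) u x~u in
                                c , ((λ _ _ → u , e , u∈B) , λ { y (_ , (x≡0 , _) , _) → x≢0 x≡0 }) , e })
                           (λ p q → just-injective (trans (sym p) q)) ⟩
        count opt?    ∎

    module C = Counting Ok ok? Hard Soft hard? soft? hard-sym soft-sym β γ (k * (W * 20)) options softs slack

  choice : Choice
  choice = record
    { F         = F
    ; to-B      = λ {a} {i} a∈A i≢0 → subst₂ (λ a′ i′ → A a′ → i′ ≢ s₀ → ∃ λ b → nb a′ (F a i) ≡ just b × B b) (owner-combine a i) (slot-combine a i)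
                    (proj₁ (proj₂ C.solution (combine a i))) a∈A i≢0
    ; proper    = λ {a} {b} a∈A b∈A a~b eq → proj₁ (proj₂ (proj₂ C.solution (combine a s₀)) (combine b s₀)
                    (λ e → adj-irrefl G (subst (Adj G a) (sym (Finₚ.combine-injectiveˡ a s₀ b s₀ e)) a~b)))
                    ((subst A (sym (owner-combine a s₀)) a∈A , subst A (sym (owner-combine b s₀)) b∈A) ,
                     (slot-combine a s₀ , slot-combine b s₀) ,
                     subst₂ (Adj G) (sym (owner-combine a s₀)) (sym (owner-combine b s₀)) a~b , eq)
    ; separated = λ {a} {i} {b} {j} a∈A b∈A distinct w t → proj₂ (proj₂ (proj₂ C.solution (combine a i)) (combine b j) (differ distinct))
                    ((subst A (sym (owner-combine a i)) a∈A , subst A (sym (owner-combine b j)) b∈A) , w ,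
                     subst₂ (λ a′ b′ → Touch a′ (F a i) b′ (F b j)) (sym (owner-combine a i)) (sym (owner-combine b j)) t)
    }
    where
    F : V → Slot → Fin k
    F a i = proj₁ C.solution (combine a i)
    owner-combine : ∀ a i → owner (combine a i) ≡ a
    owner-combine a i = cong proj₁ (Finₚ.remQuot-combine a i)
    slot-combine : ∀ a i → slot (combine a i) ≡ i
    slot-combine a i = cong proj₂ (Finₚ.remQuot-combine a i)
    differ : ∀ {a i b j} → a ≢ b ⊎ i ≢ j → combine a i ≢ combine b j
    differ {a} {i} {b} {j} (inj₁ a≢b) e = a≢b (Finₚ.combine-injectiveˡ a i b j e)
    differ {a} {i} {b} {j} (inj₂ i≢j) e = i≢j (Finₚ.combine-injectiveʳ a i b j e)

-- Recolouring the selected edges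

module Recolouring (G : Graph) (k W J Y C : ℕ) .{{_ : NonZero W}} .{{_ : NonZero Y}}
  (s : PartialColouring G k) (total : ∀ u v → Adj G u v → EdgeColouring.Coloured G k s u v)
  (inB : Fin (n G) → Bool) (chosen : Owned.Choice G k W s inB)
  (window<J : ∀ (c : Fin k) → toℕ c / W < J)
  (base<C : ∀ c → c < k → Palette.base J Y k C c < C) (X²≤C : Palette.X J Y k C * Palette.X J Y k C ≤ C)
  where

  open PartialColouring s
  open EdgeColouring G k using (maybe?; coloured?)
  open Owned G k W s inB
  open Choice chosen
  open Palette J Y k C

  private
    V = Fin (n G)

    Digits = V → Slot → ℕ

    Owns : V → V → Slot → Set
    Owns a v i = A a × nb a (F a i) ≡ just v

    opaque
      owns? : ∀ a v → Dec (∃ (Owns a v))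
      owns? a v = Finₚ.any? λ i → a? a ×-dec maybe? (nb a (F a i)) (just v)

    F-injective : ∀ {a i j} → A a → F a i ≡ F a j → i ≡ j
    F-injective {a} {i} {j} a∈A eq with i Finₚ.≟ j
    ... | yes i≡j = i≡j
    ... | no i≢j  = contradiction (inj₁ refl) (separated a∈A a∈A (inj₂ i≢j) (cong window (sym eq)))

  -- `suc` makes the colours start at 1. The order of the tests does not matter: an edge selected
  -- from both of its ends would be a pair of touching selections in one window.
  edge : Digits → V → V → ℕ
  edge dg u v with owns? u v | owns? v u | coloured? s u v
  ... | yes (i , _) | _           | _           = suc (pal i (window (F u i)) (dg u i))
  ... | no _        | yes (i , _) | _           = suc (pal i (window (F v i)) (dg v i))
  ... | no _        | no _        | yes (c , _) = suc (base (toℕ c))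
  ... | no _        | no _        | no _        = 0

  vertex : (V → ℕ) → V → ℕ
  vertex q v = if inB v then suc (free (q v)) else suc (base (toℕ (F v s₀)))

  vertex-A : ∀ q {v} → A v → vertex q v ≡ suc (base (toℕ (F v s₀)))
  vertex-A q v∈A rewrite v∈A = refl

  vertex-B : ∀ q {v} → B v → vertex q v ≡ suc (free (q v))
  vertex-B q v∈B rewrite v∈B = refl

  colouring : Digits → (V → ℕ) → TotalColouring G
  colouring dg q .vcol = vertex q
  colouring dg q .ecol = edge dg

  private
    data View (dg : Digits) (u v : V) : ℕ → Set where
      owned : ∀ a i → A a → a ≡ u ⊎ a ≡ v → nb u (F a i) ≡ just v → View dg u v (suc (pal i (window (F a i)) (dg a i)))
      plain : ∀ c → nb u c ≡ just v → ¬ ∃ (Owns u v) → ¬ ∃ (Owns v u) → View dg u v (suc (base (toℕ c)))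

    view : ∀ dg {u v} → Adj G u v → View dg u v (edge dg u v)
    view dg {u} {v} u~v with owns? u v | owns? v u | coloured? s u v
    ... | yes (i , u∈A , eq) | _                  | _            = owned u i u∈A (inj₁ refl) eq
    ... | no _               | yes (i , v∈A , eq) | _            = owned v i v∈A (inj₂ refl) (nb-sym eq)
    ... | no ¬p              | no ¬q              | yes (c , eq) = plain c eq ¬p ¬q
    ... | no _               | no _               | no ¬c        = contradiction (total u v u~v) ¬c

    owner-touches : ∀ {u a i b j} → a ≡ u ⊎ nb a (F a i) ≡ just u → b ≡ u ⊎ nb b (F b j) ≡ just u → Touch a (F a i) b (F b j)
    owner-touches (inj₁ refl) (inj₁ refl) = inj₁ refl
    owner-touches (inj₁ refl) (inj₂ q)    = inj₂ (inj₂ (inj₁ q))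
    owner-touches (inj₂ p)    (inj₁ refl) = inj₂ (inj₁ p)
    owner-touches (inj₂ p)    (inj₂ q)    = inj₂ (inj₂ (inj₂ (_ , p , q)))

    at-u : ∀ {u v a i} → a ≡ u ⊎ a ≡ v → nb u (F a i) ≡ just v → a ≡ u ⊎ nb a (F a i) ≡ just u
    at-u (inj₁ a≡u) _  = inj₁ a≡u
    at-u (inj₂ refl) e = inj₂ (nb-sym e)

    -- Each owner is u itself or is joined to u by its selected edge, so the two selections touch at
    -- u. In a common window `separated` leaves only the case that they coincide.
    same-owner : ∀ {u v w a i b j} → A a → A b → a ≡ u ⊎ a ≡ v → b ≡ u ⊎ b ≡ w → nb u (F a i) ≡ just v → nb u (F b j) ≡ just w →
      window (F a i) ≡ window (F b j) → a ≡ b × i ≡ j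
    same-owner {u} {v} {w} {a} {i} {b} {j} a∈A b∈A a∈ b∈ p q win with a Finₚ.≟ b | i Finₚ.≟ j
    ... | yes a≡b | yes i≡j = a≡b , i≡j
    ... | no a≢b  | _       = contradiction (owner-touches (at-u a∈ p) (at-u b∈ q)) (separated a∈A b∈A (inj₁ a≢b) (sym win))
    ... | yes _   | no i≢j  = contradiction (owner-touches (at-u a∈ p) (at-u b∈ q)) (separated a∈A b∈A (inj₂ i≢j) (sym win))

    not-owned : ∀ {u v a i} → A a → a ≡ u ⊎ a ≡ v → nb u (F a i) ≡ just v → ¬ ∃ (Owns u v) → ¬ ∃ (Owns v u) → ⊥
    not-owned a∈A (inj₁ refl) p ¬p ¬q = ¬p (_ , a∈A , p)
    not-owned a∈A (inj₂ refl) p ¬p ¬q = ¬q (_ , a∈A , nb-sym p)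

    swap : ∀ {a u v : V} → a ≡ u ⊎ a ≡ v → a ≡ v ⊎ a ≡ u
    swap (inj₁ p) = inj₂ p
    swap (inj₂ p) = inj₁ p

  module _ (dg : Digits) (dg<X : ∀ v i → dg v i < X) where

    private
      suc-pal≢ : ∀ {c} a i → c < k → base c ≢ pal i (window (F a i)) (dg a i)
      suc-pal≢ a i c<k = base≢pal base<C X²≤C {i = i} c<k (window<J (F a i)) (dg<X a i)

    edge-sym : ∀ {u v} → Adj G u v → edge dg u v ≡ edge dg v u
    edge-sym {u} {v} u~v with edge dg u v | view dg u~v | edge dg v u | view dg (adj-sym G u~v)
    ... | _ | owned a i a∈A a∈ p | _ | owned b j b∈A b∈ q with same-owner a∈A b∈A a∈ (swap b∈) p (nb-sym q) (cong window (nb-uniq p (nb-sym q)))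
    ...   | refl , refl = refl
    edge-sym {u} {v} u~v | _ | owned a i a∈A a∈ p | _ | plain c q ¬p ¬q = ⊥-elim (not-owned a∈A a∈ p ¬q ¬p)
    edge-sym {u} {v} u~v | _ | plain c q ¬p ¬q | _ | owned a i a∈A a∈ p = ⊥-elim (not-owned a∈A a∈ p ¬q ¬p)
    edge-sym {u} {v} u~v | _ | plain c q ¬p ¬q | _ | plain d q′ _ _ = cong (λ c → suc (base (toℕ c))) (nb-uniq q (nb-sym q′))

    edges-differ : ∀ {u v w} → Adj G u v → Adj G u w → v ≢ w → edge dg u v ≢ edge dg u w
    edges-differ {u} {v} {w} u~v u~w v≢w eq with edge dg u v | view dg u~v | edge dg u w | view dg u~w
    ... | _ | plain c q _ _ | _ | plain d q′ _ _ with Finₚ.toℕ-injective (base-injective base<C X²≤C (suc-injective eq))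
    ...   | refl = v≢w (just-injective (trans (sym q) q′))
    edges-differ u~v u~w v≢w eq | _ | plain c q _ _ | _ | owned b j _ _ _ = suc-pal≢ b j (Finₚ.toℕ<n c) (suc-injective eq)
    edges-differ u~v u~w v≢w eq | _ | owned a i _ _ _ | _ | plain d _ _ _ = suc-pal≢ a i (Finₚ.toℕ<n d) (sym (suc-injective eq))
    edges-differ u~v u~w v≢w eq | _ | owned a i a∈A a∈ p | _ | owned b j b∈A b∈ q
      with same-owner a∈A b∈A a∈ b∈ p q (pal-window base<C X²≤C i j (window<J (F a i)) (window<J (F b j)) (dg<X a i) (dg<X b j) (suc-injective eq))
    ... | refl , refl = v≢w (just-injective (trans (sym p) q))

    -- The critical case is an edge at u in A that keeps its colour `base c`: if c were the vertex
    -- colour selected by u, the edge would be owned by u through slot `s₀` and so recoloured.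
    edge≢vertex : ∀ q {u v} → Adj G u v → edge dg u v ≢ vertex q u
    edge≢vertex q {u} {v} u~v eq with edge dg u v | view dg u~v | inB u in u?
    ... | _ | owned a i _ _ _ | true  = pal≢free base<C X²≤C {i} (window<J (F a i)) (dg<X a i) (suc-injective eq)
    ... | _ | owned a i _ _ _ | false = suc-pal≢ a i (Finₚ.toℕ<n (F u s₀)) (sym (suc-injective eq))
    ... | _ | plain c _ _ _   | true  = base≢free base<C X²≤C (Finₚ.toℕ<n c) (suc-injective eq)
    ... | _ | plain c p ¬p _  | false with Finₚ.toℕ-injective (base-injective base<C X²≤C (suc-injective eq))
    ...   | refl = ¬p (s₀ , u? , p)

    edge-range : ∀ Q {u v} → Adj G u v → InRange (C + (J * X + (J + Q))) (edge dg u v)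
    edge-range Q {u} {v} u~v with edge dg u v | view dg u~v
    ... | _ | owned a i _ _ _ = s≤s z≤n , pal-bound base<C X²≤C i Q (window<J (F a i)) (dg<X a i)
    ... | _ | plain c _ _ _   = s≤s z≤n , base-bound base<C X²≤C Q (Finₚ.toℕ<n c)

  vertex-range : ∀ q Q → (∀ v → q v < Q) → ∀ v → InRange (C + (J * X + (J + Q))) (vertex q v)
  vertex-range q Q q<Q v with inB v
  ... | true  = s≤s z≤n , free-bound base<C X²≤C (q<Q v)
  ... | false = s≤s z≤n , base-bound base<C X²≤C Q (Finₚ.toℕ<n (F v s₀))

  vertices-differ : ∀ q → (∀ {u v} → B u → B v → Adj G u v → q u ≢ q v) → ∀ {u v} → Adj G u v → vertex q u ≢ vertex q v
  vertices-differ q q-proper {u} {v} u~v eq with inB u in u? | inB v in v?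
  ... | true  | true  = q-proper u? v? u~v (+-cancelˡ-≡ J _ _ (+-cancelˡ-≡ (J * X) _ _ (+-cancelˡ-≡ C _ _ (suc-injective eq))))
  ... | true  | false = base≢free base<C X²≤C (Finₚ.toℕ<n (F v s₀)) (sym (suc-injective eq))
  ... | false | true  = base≢free base<C X²≤C (Finₚ.toℕ<n (F u s₀)) (suc-injective eq)
  ... | false | false = proper u? v? u~v (Finₚ.toℕ-injective (base-injective base<C X²≤C (suc-injective eq)))

  edge-sum : Digits → V → ℕ
  edge-sum dg v = ∑ λ u → if adj G v u then edge dg v u else 0

  weighted : ∀ dg q v → weightedDegree G (colouring dg q) v ≡ vertex q v + edge-sum dg v
  weighted dg q v = cong (vertex q v +_) (sum-map-allFin λ u → if adj G v u then edge dg v u else 0)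

  -- Edges to A owned by the other end lie in slot s₀, whose colour does not depend on the digit.
  edge-sum-A : ∀ dg {a} → A a → edge-sum dg a ≡ edge-sum (λ _ _ → 0) a + ∑ (λ i → scale i * dg a i)
  edge-sum-A dg {a} a∈A = begin
    edge-sum dg a                                    ≡⟨ ∑-cong per-v ⟩
    ∑ (λ v → e₀ v + S v)                             ≡⟨ ∑-distrib-+ e₀ S ⟩
    edge-sum (λ _ _ → 0) a + ∑ S                     ≡⟨ cong (edge-sum (λ _ _ → 0) a +_) (∑-comm (λ v i → ι (hits? i v) * (scale i * dg a i))) ⟩
    edge-sum (λ _ _ → 0) a + ∑ (λ i → ∑ λ v → ι (hits? i v) * (scale i * dg a i))
      ≡⟨ cong (edge-sum (λ _ _ → 0) a +_) (∑-cong λ i → trans (∑-cong λ v → *-comm (ι (hits? i v)) _) (trans (sym (∑-scale (scale i * dg a i) (λ v → ι (hits? i v)))) (once i))) ⟩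
    edge-sum (λ _ _ → 0) a + ∑ (λ i → scale i * dg a i)  ∎
    where
    open ≡-Reasoning
    hits? : ∀ i v → Dec (nb a (F a i) ≡ just v)
    hits? i v = maybe? (nb a (F a i)) (just v)
    e₀ S : V → ℕ
    e₀ v = if adj G a v then edge (λ _ _ → 0) a v else 0
    S v = ∑ λ i → ι (hits? i v) * (scale i * dg a i)
    S-zero : ∀ {v} → (∀ i → nb a (F a i) ≢ just v) → S v ≡ 0
    S-zero {v} none = ∑-zero _ λ i → cong (_* (scale i * dg a i)) (ι-no (hits? i v) (none i))
    S-one : ∀ {v i} → nb a (F a i) ≡ just v → S v ≡ scale i * dg a i
    S-one {v} {i} eq = begin
      S v                                                   ≡⟨ ∑-cong (λ j → trans (*-comm (ι (hits? j v)) _) (only j)) ⟩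
      ∑ (λ j → scale i * dg a i * ι (j Finₚ.≟ i))           ≡⟨ ∑-scale (scale i * dg a i) (λ j → ι (j Finₚ.≟ i)) ⟨
      scale i * dg a i * count (Finₚ._≟ i)                  ≡⟨ cong (scale i * dg a i *_) (count-single i) ⟩
      scale i * dg a i * 1                                  ≡⟨ *-identityʳ _ ⟩
      scale i * dg a i                                      ∎
      where
      only : ∀ j → scale j * dg a j * ι (hits? j v) ≡ scale i * dg a i * ι (j Finₚ.≟ i)
      only j with j Finₚ.≟ i
      ... | yes refl = cong (scale i * dg a i *_) (ι-yes (hits? i v) eq)
      ... | no j≢i   = trans (cong (scale j * dg a j *_) (ι-no (hits? j v) λ eq′ → j≢i (F-injective a∈A (nb-uniq eq′ eq))))
                         (trans (*-zeroʳ (scale j * dg a j)) (sym (*-zeroʳ (scale i * dg a i))))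
    slot-zero : ∀ {v i} → Owns v a i → i ≡ s₀
    slot-zero {v} {i} (v∈A , eq) with i Finₚ.≟ s₀
    ... | yes i≡0 = i≡0
    ... | no i≢0 with to-B v∈A i≢0
    ...   | b , eq′ , b∈B with just-injective (trans (sym eq) eq′)
    ...     | refl = contradiction (trans (sym a∈A) b∈B) λ ()
    per-edge : ∀ v → edge dg a v ≡ edge (λ _ _ → 0) a v + S v
    per-edge v with owns? a v | owns? v a | coloured? s a v
    ... | yes (i , _ , eq) | _ | _ = cong suc (trans (pal-linear i _ (dg a i)) (cong (pal i (window (F a i)) 0 +_) (sym (S-one eq))))
    ... | no ¬p | yes (i , o) | _ with slot-zero o
    ...   | refl = trans (sym (+-identityʳ _)) (cong (suc (C + (J * X + window (F v s₀))) +_) (sym (S-zero λ i eq → ¬p (i , a∈A , eq))))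
    per-edge v | no ¬p | no _ | yes (c , _) = trans (sym (+-identityʳ _)) (cong (suc (base (toℕ c)) +_) (sym (S-zero λ i eq → ¬p (i , a∈A , eq))))
    per-edge v | no ¬p | no _ | no _ = sym (S-zero λ i eq → ¬p (i , a∈A , eq))
    per-v : ∀ v → (if adj G a v then edge dg a v else 0) ≡ e₀ v + S v
    per-v v with adj G a v in eq
    ... | true  = per-edge v
    ... | false = sym (S-zero λ i eq′ → contradiction (trans (sym eq) (nb-adj eq′)) λ ())
    once : ∀ i → scale i * dg a i * count (hits? i) ≡ scale i * dg a i
    once s₀ = refl
    once i@(suc _) with to-B {a} {i} a∈A (λ ())
    ... | b , eq , _ = trans (cong (scale i * dg a i *_) (≤-antisym
            (count-unique (hits? i) λ p q → just-injective (trans (sym p) q))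
            (≤-trans (ι-pos (hits? i b) eq) (term≤∑ (λ v → ι (hits? i v)) b)))) (*-identityʳ _)

-- Adjusting the sums on A and colouring B

module Distinguishing (G : Graph) (Δ k W J Y C D : ℕ) .{{_ : NonZero W}} .{{_ : NonZero Y}}
  (degree≤Δ : ∀ v → count (adj? G v) ≤ Δ)
  (s : PartialColouring G k) (total : ∀ u v → Adj G u v → EdgeColouring.Coloured G k s u v)
  (inB : Fin (n G) → Bool) (chosen : Owned.Choice G k W s inB)
  (few-B : ∀ v → inB v ≡ true → count (λ u → (u Finₚ.<? v) ×-dec adj? G v u ×-dec (inB u Boolₚ.≟ true)) ≤ D)
  (window<J : ∀ (c : Fin k) → toℕ c / W < J)
  (base<C : ∀ c → c < k → Palette.base J Y k C c < C) (X²≤C : Palette.X J Y k C * Palette.X J Y k C ≤ C)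
  (range : Δ * 2 + 2 ≤ suc (3 * pred (Palette.X J Y k C)) * Palette.X J Y k C)
  where

  open Owned G k W s inB
  open Choice chosen
  open Palette J Y k C
  open Recolouring G k W J Y C s total inB chosen window<J base<C X²≤C

  private
    V = Fin (n G)

    opaque
      half↑ : ℕ → ℕ
      half↑ m = m % 2 + m / 2

      -- Adding the parity bit makes the sum even, and comparing two such sums becomes comparing
      -- halves shifted by j. This brings the sums into the form treated by `greedy-shifts`.
      round-up : ∀ m j → m + (j * 2 + m % 2) ≡ 2 * (half↑ m + j)
      round-up m j = trans (cong (_+ (j * 2 + m % 2)) (m≡m%n+[m/n]*n m 2)) (lemma (m % 2) (m / 2) j)
        where
        lemma : ∀ r h j → r + h * 2 + (j * 2 + r) ≡ 2 * (r + h + j)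
        lemma = solve-∀

    doubled< : ∀ {j M} m → j < suc M → j * 2 + m % 2 < M * 2 + 2
    doubled< {j} {M} m j<1+M = subst (j * 2 + m % 2 <_) (+-comm 2 (M * 2)) (digits-< {2} j<1+M (m%n<n m 2))

    K : V → ℕ
    K a = suc (base (toℕ (F a s₀))) + edge-sum (λ _ _ → 0) a

    Aʳ : V → V → Set
    Aʳ v u = A v × A u × Adj G v u

    j₁ : ∃ λ (j : V → Fin (suc Δ)) → ∀ {v u} → Aʳ v u → ∀ (_ : Fin 1) → half↑ (K v) + toℕ (j v) ≢ half↑ (K u) + toℕ (j u)
    j₁ = greedy-shifts (λ v u → a? v ×-dec a? u ×-dec adj? G v u) (λ _ → half↑ ∘ K) Δ
      (λ { (p , q , a) → q , p , adj-sym G a }) (λ { (_ , _ , a) → adj-irrefl G a })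
      (λ v → ≤-trans (≤-reflexive (+-identityʳ _)) (≤-trans (count-mono _ (adj? G v) λ { _ (_ , _ , _ , a) → a }) (degree≤Δ v)))

    dg : V → Slot → ℕ
    dg v = digit (toℕ (proj₁ j₁ v) * 2 + K v % 2)

    dg<X : ∀ v i → dg v i < X
    dg<X v i = digit<X i (<-≤-trans (doubled< (K v) (Finₚ.toℕ<n (proj₁ j₁ v))) range)

    -- One more than the sum at b when q b = 0. Of the 2, one unit is the `suc` in the vertex
    -- colour; the other makes an even total `L b + q b` mean an odd sum at b.
    L : V → ℕ
    L b = 2 + (C + (J * X + J)) + edge-sum dg b

    Bʳ : V → V → Set
    Bʳ v u = B v × B u × Adj G v u

    bʳ? : ∀ v u → Dec (Bʳ v u)
    bʳ? v u = b? v ×-dec b? u ×-dec adj? G v u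

    -- Index 0 separates the sums and index 1 the vertex colours. At most D earlier neighbours with
    -- two conditions each leave a choice among 2D + 1 shifts; the parity bit doubles this to 4D + 2
    -- colours.
    shift : Fin 2 → V → ℕ
    shift zero    b = half↑ (L b)
    shift (suc _) b = 0

    j₂ : ∃ λ (j : V → Fin (suc (2 * D))) → ∀ {v u} → Bʳ v u → ∀ i → shift i v + toℕ (j v) ≢ shift i u + toℕ (j u)
    j₂ = greedy-shifts bʳ? shift (2 * D) (λ { (p , q , a) → q , p , adj-sym G a }) (λ { (_ , _ , a) → adj-irrefl G a })
      λ v → *-monoʳ-≤ 2 (by v (b? v))
      where
      by : ∀ v → Dec (B v) → count (λ u → (u Finₚ.<? v) ×-dec bʳ? v u) ≤ D
      by v (yes v∈B) = ≤-trans (count-mono (λ u → (u Finₚ.<? v) ×-dec bʳ? v u) (λ u → (u Finₚ.<? v) ×-dec adj? G v u ×-dec b? u)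
        λ { _ (lt , _ , u∈B , a) → lt , a , u∈B }) (few-B v v∈B)
      by v (no v∉B) = ≤-trans (≤-reflexive (∑-zero _ λ u → ι-no ((u Finₚ.<? v) ×-dec bʳ? v u) λ { (_ , v∈B , _) → v∉B v∈B })) z≤n

    q : V → ℕ
    q b = toℕ (proj₁ j₂ b) * 2 + L b % 2

    q-proper : ∀ {u v} → B u → B v → Adj G u v → q u ≢ q v
    q-proper {u} {v} u∈B v∈B u~v eq = proj₂ j₂ (u∈B , v∈B , u~v) (suc zero)
      (proj₁ (digits-unique {2} _ _ (m%n<n (L u) 2) (m%n<n (L v) 2) eq))

    σᴬ σᴮ : V → ℕ
    σᴬ a = half↑ (K a) + toℕ (proj₁ j₁ a)
    σᴮ b = half↑ (L b) + toℕ (proj₁ j₂ b)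

    c : TotalColouring G
    c = colouring dg q

    sum-A : ∀ {a} → A a → weightedDegree G c a ≡ 2 * (σᴬ a)
    sum-A {a} a∈A = begin
      weightedDegree G c a                                                         ≡⟨ weighted dg q a ⟩
      vertex q a + edge-sum dg a                                                   ≡⟨ cong₂ _+_ (vertex-A q a∈A) (edge-sum-A dg a∈A) ⟩
      suc (base (toℕ (F a s₀))) + (edge-sum (λ _ _ → 0) a + ∑ (λ i → scale i * dg a i))   ≡⟨ +-assoc (suc (base (toℕ (F a s₀)))) _ _ ⟨
      K a + ∑ (λ i → scale i * dg a i)                                             ≡⟨ cong (K a +_) (digit-sum _) ⟩
      K a + (toℕ (proj₁ j₁ a) * 2 + K a % 2)                                       ≡⟨ round-up (K a) _ ⟩
      2 * (σᴬ a)                                         ∎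
      where open ≡-Reasoning

    sum-B : ∀ {b} → B b → suc (weightedDegree G c b) ≡ 2 * (σᴮ b)
    sum-B {b} b∈B = begin
      suc (weightedDegree G c b)                                     ≡⟨ cong suc (weighted dg q b) ⟩
      suc (vertex q b + edge-sum dg b)                               ≡⟨ cong (λ z → suc (z + edge-sum dg b)) (vertex-B q b∈B) ⟩
      2 + (C + (J * X + (J + q b))) + edge-sum dg b                  ≡⟨ lemma C (J * X) J (q b) (edge-sum dg b) ⟩
      L b + q b                                                      ≡⟨ round-up (L b) _ ⟩
      2 * (σᴮ b)                           ∎
      where
      open ≡-Reasoning
      lemma : ∀ c x j q e → 2 + (c + (x + (j + q))) + e ≡ 2 + (c + (x + j)) + e + q
      lemma = solve-∀

    distinguishing : IsNSD G c
    distinguishing u v u~v eq = by _ _ refl refl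
      where
      by : ∀ x y → inB u ≡ x → inB v ≡ y → ⊥
      by false false u∈A v∈A = proj₂ j₁ (u∈A , v∈A , u~v) zero (*-cancelˡ-≡ (σᴬ u) (σᴬ v) 2 (trans (sym (sum-A u∈A)) (trans eq (sum-A v∈A))))
      by true  true  u∈B v∈B = proj₂ j₂ (u∈B , v∈B , u~v) zero (*-cancelˡ-≡ (σᴮ u) (σᴮ v) 2 (trans (sym (sum-B u∈B)) (trans (cong suc eq) (sum-B v∈B))))
      by true  false u∈B v∈A = even≢odd (σᴮ u) (σᴬ v) (trans (sym (sum-B u∈B)) (cong suc (trans eq (sum-A v∈A))))
      by false true  u∈A v∈B = even≢odd (σᴮ v) (σᴬ u) (trans (sym (sum-B v∈B)) (cong suc (trans (sym eq) (sum-A u∈A))))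

  hasNSDTotal : HasNSDTotal G (C + (J * X + (J + (2 * D * 2 + 2))))
  hasNSDTotal = c ,
    ( vertex-range q _ (λ v → doubled< (L v) (Finₚ.toℕ<n (proj₁ j₂ v)))
    , (λ u v u~v → edge-range dg dg<X _ u~v)
    , (λ u v u~v → edge-sym dg dg<X u~v)
    , (λ u v u~v → vertices-differ q q-proper u~v)
    , (λ u v w u~v u~w v≢w → edges-differ dg dg<X u~v u~w v≢w)
    , (λ u v u~v → edge≢vertex dg dg<X q u~v)) ,
    distinguishing

-- Bounds on the exponential

expScaled-≤ : ∀ a m → expScaled a m ≤ suc a ^ m * m !
expScaled-≤ a zero    = ≤-refl
expScaled-≤ a (suc m) = begin
  suc m * expScaled a m + a * a ^ m                      ≤⟨ +-mono-≤ (*-monoʳ-≤ (suc m) (expScaled-≤ a m)) tail ⟩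
  suc m * (p * m !) + a * p * (suc m !)                  ≡⟨ lemma (suc m) p (m !) a ⟩
  suc a * p * (suc m !)                                  ∎
  where
  open ≤-Reasoning
  p = suc a ^ m
  tail : a * a ^ m ≤ a * p * (suc m !)
  tail = ≤-trans (*-monoʳ-≤ a (^-monoˡ-≤ m (n≤1+n a))) (m≤m*n (a * p) (suc m !) {{>-nonZero (1≤n! (suc m))}})
  lemma : ∀ s p f a → s * (p * f) + a * p * (s * f) ≡ suc a * p * (s * f)
  lemma = solve-∀

-- Beyond m = 2a each term of the exponential series is at most half the previous one, so the last term bounds the tail.
expScaled-bounded : ∀ a m → expScaled a m ≤ 2 * suc a ^ (2 * a) * m !
expScaled-bounded a m with m ≤? 2 * a
... | yes m≤2a = ≤-trans (expScaled-≤ a m) (*-monoˡ-≤ (m !) (≤-trans (^-monoʳ-≤ (suc a) m≤2a) (m≤m+n _ _)))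
... | no m≰2a = subst (λ m → expScaled a m ≤ B * m !) (m∸n+n≡m (<⇒≤ (≰⇒> m≰2a))) (≤-trans (m≤m+n _ _) (with-tail (m ∸ 2 * a)))
  where
  open ≤-Reasoning
  B = 2 * suc a ^ (2 * a)
  with-tail : ∀ i → expScaled a (i + 2 * a) + a ^ (i + 2 * a) ≤ B * (i + 2 * a) !
  with-tail zero = begin
    expScaled a (2 * a) + a ^ (2 * a)            ≤⟨ +-mono-≤ (expScaled-≤ a (2 * a)) (≤-trans (^-monoˡ-≤ (2 * a) (n≤1+n a)) (m≤m*n p ((2 * a) !) {{>-nonZero (1≤n! (2 * a))}})) ⟩
    p * (2 * a) ! + p * (2 * a) !                ≡⟨ lemma p ((2 * a) !) ⟩
    2 * p * (2 * a) !                            ∎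
    where
    p = suc a ^ (2 * a)
    lemma : ∀ p f → p * f + p * f ≡ 2 * p * f
    lemma = solve-∀
  with-tail (suc i) = begin
    suc j * expScaled a j + a * a ^ j + a * a ^ j      ≡⟨ lemma (suc j * expScaled a j) a (a ^ j) ⟩
    suc j * expScaled a j + (2 * a) * a ^ j            ≤⟨ +-monoʳ-≤ (suc j * expScaled a j) (*-monoˡ-≤ (a ^ j) (≤-trans (m≤n+m (2 * a) i) (n≤1+n j))) ⟩
    suc j * expScaled a j + suc j * a ^ j              ≡⟨ *-distribˡ-+ (suc j) (expScaled a j) (a ^ j) ⟨
    suc j * (expScaled a j + a ^ j)                    ≤⟨ *-monoʳ-≤ (suc j) (with-tail i) ⟩
    suc j * (B * j !)                                  ≡⟨ lemma₂ (suc j) B (j !) ⟩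
    B * (suc j !)                                      ∎
    where
    j = i + 2 * a
    lemma : ∀ e a p → e + a * p + a * p ≡ e + (2 * a) * p
    lemma = solve-∀
    lemma₂ : ∀ s b f → s * (b * f) ≡ b * (s * f)
    lemma₂ = solve-∀

-- By `expScaled-bounded`, e^a is at most 2 (a + 1)^(2a). The 2 is bounded by one factor Δ and the
-- power by Δ^(12a), which gives the exponent 12a + 1.
exp-≤-power : ∀ a b Δ → 2 ≤ Δ → suc a ≤ Δ ^ 6 → suc (6 * (2 * a)) ≤ b → ExpLe a (Δ ^ b)
exp-≤-power a b Δ 2≤Δ a<Δ⁶ le m = ≤-trans (expScaled-bounded a m) (*-monoˡ-≤ (m !) (begin
  2 * suc a ^ (2 * a)            ≤⟨ *-mono-≤ 2≤Δ (^-monoˡ-≤ (2 * a) a<Δ⁶) ⟩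
  Δ * (Δ ^ 6) ^ (2 * a)          ≡⟨ cong (Δ *_) (^-*-assoc Δ 6 (2 * a)) ⟩
  Δ ^ suc (6 * (2 * a))          ≤⟨ ^-monoʳ-≤ Δ {{>-nonZero (≤-trans (s≤s z≤n) 2≤Δ)}} le ⟩
  Δ ^ b                          ∎))
  where open ≤-Reasoning

-- Sixth roots

sixth-root : ∀ Δ → ∃ λ N → N ^ 6 ≤ Δ × Δ < suc N ^ 6
sixth-root zero = 0 , z≤n , s≤s z≤n
sixth-root (suc Δ) with sixth-root Δ
... | N , lo , hi with m≤n⇒m<n∨m≡n hi
...   | inj₁ lt = N , ≤-trans lo (n≤1+n Δ) , lt
...   | inj₂ eq = suc N , ≤-reflexive (sym eq) , <-≤-trans (s≤s (≤-reflexive eq)) (^-monoˡ-< 6 (n<1+n (suc N)))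

^-distrib-* : ∀ m n i → (m * n) ^ i ≡ m ^ i * n ^ i
^-distrib-* m n zero    = refl
^-distrib-* m n (suc i) = trans (cong (m * n *_) (^-distrib-* m n i)) ([m*n]*[o*p]≡[m*o]*[n*p] m n (m ^ i) (n ^ i))

-- 63 = 2^6 - 1 is the sum of the binomial coefficients of the lower powers, each of which is at
-- most N^5. Raising the exponent by one turns the constant a into 2a + 1.
suc-power-≤ : ∀ N .{{_ : NonZero N}} → suc N ^ 6 ≤ N ^ 6 + 63 * N ^ 5
suc-power-≤ N = step 4 31 (step 3 15 (step 2 7 (step 1 3 (step 0 1 (≤-reflexive (lemma N))))))
  where
  open ≤-Reasoning
  lemma : ∀ N → suc N * 1 ≡ N * 1 + 1 * 1
  lemma = solve-∀
  step : ∀ i a → suc N ^ suc i ≤ N ^ suc i + a * N ^ i → suc N ^ suc (suc i) ≤ N ^ suc (suc i) + suc (2 * a) * N ^ suc i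
  step i a h = begin
    suc N * suc N ^ suc i                                        ≤⟨ *-monoʳ-≤ (suc N) h ⟩
    suc N * (N ^ suc i + a * N ^ i)                              ≡⟨ expand N (N ^ i) a ⟩
    N ^ suc (suc i) + (suc a * N ^ suc i + a * N ^ i)            ≤⟨ +-monoʳ-≤ (N ^ suc (suc i)) (+-monoʳ-≤ (suc a * N ^ suc i) (*-monoʳ-≤ a (m≤n*m (N ^ i) N))) ⟩
    N ^ suc (suc i) + (suc a * N ^ suc i + a * N ^ suc i)        ≡⟨ collect (N ^ suc (suc i)) a (N ^ suc i) ⟩
    N ^ suc (suc i) + suc (2 * a) * N ^ suc i                    ∎
    where
    expand : ∀ N p a → suc N * (N * p + a * p) ≡ N * (N * p) + (suc a * (N * p) + a * p)
    expand = solve-∀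
    collect : ∀ x a p → x + (suc a * p + a * p) ≡ x + suc (2 * a) * p
    collect = solve-∀

exp-bound : ∀ c d E Δ → 2 ≤ Δ → E ≤ c * Δ ^ 5 → suc c ≤ Δ → suc (6 * (2 * c)) ≤ d → ExpLe E (Δ ^ (d * Δ ^ 5))
exp-bound c d E Δ 2≤Δ E≤ c<Δ 12c<d = exp-≤-power E (d * Δ ^ 5) Δ 2≤Δ
  (begin
    suc E                                    ≤⟨ +-mono-≤ 1≤Δ⁵ E≤ ⟩
    suc c * Δ ^ 5                            ≤⟨ *-monoˡ-≤ (Δ ^ 5) c<Δ ⟩
    Δ ^ 6                                    ∎)
  (begin
    suc (6 * (2 * E))                        ≤⟨ +-mono-≤ 1≤Δ⁵ (*-monoʳ-≤ 6 (*-monoʳ-≤ 2 E≤)) ⟩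
    Δ ^ 5 + 6 * (2 * (c * Δ ^ 5))            ≡⟨ lemma (Δ ^ 5) c ⟩
    suc (6 * (2 * c)) * Δ ^ 5                ≤⟨ *-monoˡ-≤ (Δ ^ 5) 12c<d ⟩
    d * Δ ^ 5                                ∎)
  where
  open ≤-Reasoning
  1≤Δ⁵ : 1 ≤ Δ ^ 5
  1≤Δ⁵ = m^n>0 Δ {{>-nonZero (≤-trans (s≤s z≤n) 2≤Δ)}} 5
  lemma : ∀ x c → x + 6 * (2 * (c * x)) ≡ suc (6 * (2 * c)) * x
  lemma = solve-∀

-- As (N^5)^6 = (N^6)^5 ≤ Δ^5, a bound linear in N^5 becomes one linear in Δ^5 after raising to the
-- sixth power, and no fractional exponents are needed.
exp-root-bound : ∀ e f Δ N {E} → 2 ≤ Δ → N ^ 6 ≤ Δ → E ≤ e * N ^ 5 → suc (e ^ 6) ≤ Δ → suc (6 * (2 * e ^ 6)) ≤ f ^ 6 →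
  ExpLe (E ^ 6) (Δ ^ (f ^ 6 * Δ ^ 5))
exp-root-bound e f Δ N {E} 2≤Δ N⁶≤Δ E≤ e⁶<Δ e≪f = exp-bound (e ^ 6) (f ^ 6) (E ^ 6) Δ 2≤Δ (begin
  E ^ 6                    ≤⟨ ^-monoˡ-≤ 6 E≤ ⟩
  (e * N ^ 5) ^ 6          ≡⟨ ^-distrib-* e (N ^ 5) 6 ⟩
  e ^ 6 * (N ^ 5) ^ 6      ≡⟨ cong (e ^ 6 *_) (trans (^-*-assoc N 5 6) (sym (^-*-assoc N 6 5))) ⟩
  e ^ 6 * (N ^ 6) ^ 5      ≤⟨ *-monoʳ-≤ (e ^ 6) (^-monoˡ-≤ 5 N⁶≤Δ) ⟩
  e ^ 6 * Δ ^ 5            ∎) e⁶<Δ e≪f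
  where open ≤-Reasoning

-- Choice of parameters

module Parameters (Δ N : ℕ) (N≥150 : 150 ≤ N) (lower : N ^ 6 ≤ Δ) (upper : Δ < suc N ^ 6) where

  private
    at-least : ∀ m → {T (m ≤ᵇ 150)} → m ≤ N
    at-least m {le} = ≤-trans (≤ᵇ⇒≤ m 150 le) N≥150

  -- In units of p = N^5, `slack` reads 6² + 30 ≤ 6 · 11, where 30 comes from 20 k W with k ≤ 3 N^6
  -- / 2. Since β + 30/β is always above 10, 11 is the least integer factor for D. There are at most
  -- J = 2N² windows because k / W is at most 3N² / 2. Y is chosen so that X = N^3.
  a b p k W J Y C D β : ℕ
  a = N * N
  b = N * a
  p = a * b
  D = 11 * p
  k = Δ + D
  W = a * a
  J = 2 * a
  Y = a * (N ∸ 6)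
  C = k + 6 * a * (3 * b + 1)
  β = 6 * p

  open Palette J Y k C using (X; base)

  private
    N≥1 : 1 ≤ N
    N≥1 = at-least 1
    a≥1 : 1 ≤ a
    a≥1 = *-mono-≤ N≥1 N≥1
    b≥1 : 1 ≤ b
    b≥1 = *-mono-≤ N≥1 a≥1
    p≥1 : 1 ≤ p
    p≥1 = *-mono-≤ a≥1 b≥1

  instance
    W≢0 : NonZero W
    W≢0 = >-nonZero (*-mono-≤ a≥1 a≥1)
    Y≢0 : NonZero Y
    Y≢0 = >-nonZero (*-mono-≤ a≥1 (m<n⇒0<n∸m {6} (at-least 7)))
    k≢0 : NonZero k
    k≢0 = >-nonZero (≤-trans p≥1 (≤-trans (m≤n*m p 11) (m≤n+m D Δ)))
    β≢0 : NonZero β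
    β≢0 = >-nonZero (≤-trans p≥1 (m≤n*m p 6))

  p≡N⁵ : p ≡ N ^ 5
  p≡N⁵ = lemma N
    where
    lemma : ∀ N → N * N * (N * (N * N)) ≡ N * (N * (N * (N * (N * 1))))
    lemma = solve-∀

  private
    b²≡N⁶ : b * b ≡ N ^ 6
    b²≡N⁶ = lemma N
      where
      lemma : ∀ N → N * (N * N) * (N * (N * N)) ≡ N * (N * (N * (N * (N * (N * 1)))))
      lemma = solve-∀

    b²≡Np : b * b ≡ N * p
    b²≡Np = lemma N a
      where
      lemma : ∀ N a → N * a * (N * a) ≡ N * (a * (N * a))
      lemma = solve-∀

    b²≤Δ : b * b ≤ Δ
    b²≤Δ = subst (_≤ Δ) (sym b²≡N⁶) lower

    open ≤-Reasoning

  -- The terms of order N^5 add up to 2 (63 + 11) = 148 times N^5, and N ≥ 150 lets the remaining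
  -- N^6 absorb them.
  2k≤3b² : 2 * k ≤ 3 * (b * b)
  2k≤3b² = begin
    2 * (Δ + 11 * p)                    ≤⟨ *-monoʳ-≤ 2 (+-monoˡ-≤ (11 * p) (≤-trans (<⇒≤ upper) (suc-power-≤ N {{>-nonZero N≥1}}))) ⟩
    2 * (N ^ 6 + 63 * N ^ 5 + 11 * p)   ≡⟨ cong₂ (λ x y → 2 * (x + 63 * y + 11 * p)) b²≡N⁶ p≡N⁵ ⟨
    2 * (b * b + 63 * p + 11 * p)       ≡⟨ lemma (b * b) p ⟩
    2 * (b * b) + 148 * p               ≤⟨ +-monoʳ-≤ (2 * (b * b)) (*-monoˡ-≤ p (at-least 148)) ⟩
    2 * (b * b) + N * p                 ≡⟨ cong (2 * (b * b) +_) b²≡Np ⟨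
    2 * (b * b) + b * b                 ≡⟨ lemma₂ (b * b) ⟩
    3 * (b * b)                         ∎
    where
    lemma : ∀ x p → 2 * (x + 63 * p + 11 * p) ≡ 2 * x + 148 * p
    lemma = solve-∀
    lemma₂ : ∀ x → 2 * x + x ≡ 3 * x
    lemma₂ = solve-∀

  k<D² : k < D * D
  k<D² = begin-strict
    k                   ≤⟨ m≤n*m k 2 ⟩
    2 * k               ≤⟨ 2k≤3b² ⟩
    3 * (b * b)         ≡⟨ cong (3 *_) b²≡Np ⟩
    3 * (N * p)         ≤⟨ *-monoʳ-≤ 3 (*-monoˡ-≤ p N≤p) ⟩
    3 * (p * p)         <⟨ *-monoˡ-< (p * p) {{>-nonZero (*-mono-≤ p≥1 p≥1)}} {3} {121} (m≤m+n 4 117) ⟩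
    121 * (p * p)       ≡⟨ lemma p ⟩
    D * D               ∎
    where
    lemma : ∀ p → 121 * (p * p) ≡ 11 * p * (11 * p)
    lemma = solve-∀
    N≤p : N ≤ p
    N≤p = begin
      N       ≤⟨ m≤m*n N a {{>-nonZero a≥1}} ⟩
      b       ≤⟨ m≤n*m b a {{>-nonZero a≥1}} ⟩
      p       ∎

  slack : β * β + k * (W * 20) ≤ β * D
  slack = begin
    6 * p * (6 * p) + k * (a * a * 20)          ≡⟨ cong (6 * p * (6 * p) +_) (lemma k (a * a)) ⟩
    6 * p * (6 * p) + 2 * k * (10 * (a * a))    ≤⟨ +-monoʳ-≤ (6 * p * (6 * p)) (*-monoˡ-≤ (10 * (a * a)) 2k≤3b²) ⟩
    6 * p * (6 * p) + 3 * (b * b) * (10 * (a * a))  ≡⟨ lemma₂ a b ⟩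
    6 * p * (11 * p)                            ∎
    where
    lemma : ∀ k w → k * (w * 20) ≡ 2 * k * (10 * w)
    lemma = solve-∀
    lemma₂ : ∀ a b → 6 * (a * b) * (6 * (a * b)) + 3 * (b * b) * (10 * (a * a)) ≡ 6 * (a * b) * (11 * (a * b))
    lemma₂ = solve-∀

  window<J : ∀ (c : Fin k) → toℕ c / W < J
  window<J c = m<n*o⇒m/o<n (*-cancelˡ-< 2 (toℕ c) (J * W) (begin-strict
    2 * toℕ c          <⟨ *-monoʳ-< 2 (Finₚ.toℕ<n c) ⟩
    2 * k              ≤⟨ 2k≤3b² ⟩
    3 * (b * b)        ≤⟨ *-monoˡ-≤ (b * b) (m≤m+n 3 1) ⟩
    4 * (b * b)        ≡⟨ lemma N ⟩
    2 * (J * W)        ∎))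
    where
    lemma : ∀ N → 4 * (N * (N * N) * (N * (N * N))) ≡ 2 * (2 * (N * N) * (N * N * (N * N)))
    lemma = solve-∀

  X≡b : X ≡ b
  X≡b = begin-equality
    3 * (2 * a) + a * (N ∸ 6)      ≡⟨ lemma a (N ∸ 6) ⟩
    (6 + (N ∸ 6)) * a              ≡⟨ cong (_* a) (m+[n∸m]≡n (at-least 6)) ⟩
    N * a                          ∎
    where
    lemma : ∀ a m → 3 * (2 * a) + a * m ≡ (6 + m) * a
    lemma = solve-∀

  X²≤C : X * X ≤ C
  X²≤C = subst (λ x → x * x ≤ C) (sym X≡b) (≤-trans b²≤Δ (≤-trans (m≤m+n Δ D) (m≤m+n k _)))

  -- `base` skips 3 J = 6 a residues for every started block of Y colours. As k ≤ 3 b² / 2 and Y ≥ b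
  -- / 2, the quotient c / Y is below 3 b, whence the summand 6 a (3 b + 1) of C.
  base<C : ∀ c → c < k → base c < C
  base<C c c<k = begin-strict
    (c / Y) * X + (3 * J + c % Y)                  ≡⟨ lemma (c / Y) (3 * J) Y (c % Y) ⟩
    c % Y + (c / Y) * Y + 3 * J * (c / Y + 1)      ≡⟨ cong₂ _+_ (m≡m%n+[m/n]*n c Y) (cong (_* (c / Y + 1)) (*-assoc 3 2 a)) ⟨
    c + 6 * a * (c / Y + 1)                        <⟨ +-mono-<-≤ c<k (*-monoʳ-≤ (6 * a) (+-monoˡ-≤ 1 (<⇒≤ quotient<))) ⟩
    k + 6 * a * (3 * b + 1)                        ∎
    where
    lemma : ∀ q h y r → q * (h + y) + (h + r) ≡ r + q * y + h * (q + 1)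
    lemma = solve-∀
    b≤2Y : b ≤ 2 * Y
    b≤2Y = begin
      N * a                          ≤⟨ *-monoˡ-≤ a half ⟩
      2 * (N ∸ 6) * a                ≡⟨ lemma₂ (N ∸ 6) a ⟩
      2 * (a * (N ∸ 6))              ∎
      where
      lemma₂ : ∀ m a → 2 * m * a ≡ 2 * (a * m)
      lemma₂ = solve-∀
      half : N ≤ 2 * (N ∸ 6)
      half = begin
        N                            ≡⟨ m+[n∸m]≡n (at-least 6) ⟨
        6 + (N ∸ 6)                  ≤⟨ +-monoˡ-≤ (N ∸ 6) (∸-monoˡ-≤ 6 (at-least 12)) ⟩
        (N ∸ 6) + (N ∸ 6)            ≡⟨ cong ((N ∸ 6) +_) (+-identityʳ (N ∸ 6)) ⟨
        2 * (N ∸ 6)                  ∎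
    quotient< : c / Y < 3 * b
    quotient< = m<n*o⇒m/o<n (*-cancelˡ-< 2 c (3 * b * Y) (begin-strict
      2 * c              <⟨ *-monoʳ-< 2 c<k ⟩
      2 * k              ≤⟨ 2k≤3b² ⟩
      3 * (b * b)        ≤⟨ *-monoʳ-≤ 3 (*-monoʳ-≤ b b≤2Y) ⟩
      3 * (b * (2 * Y))  ≡⟨ lemma₃ b Y ⟩
      2 * (3 * b * Y)    ∎))
      where
      lemma₃ : ∀ b y → 3 * (b * (2 * y)) ≡ 2 * (3 * b * y)
      lemma₃ = solve-∀

  -- The right side is 3 X² - 2 X, and 2 k ≤ 3 X² has room for the missing 2 X. Two top slots would
  -- reach only 2 X² - X, which is below 2 Δ + 2; hence three.
  range : Δ * 2 + 2 ≤ suc (3 * pred X) * X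
  range = subst (λ x → Δ * 2 + 2 ≤ suc (3 * pred x) * x) (sym X≡b) (+-cancelʳ-≤ (2 * b) _ _ (begin
    Δ * 2 + 2 + 2 * b                       ≤⟨ +-mono-≤ (+-monoʳ-≤ (Δ * 2) (*-monoʳ-≤ 2 p≥1)) (*-monoʳ-≤ 2 (m≤n*m b a {{>-nonZero a≥1}})) ⟩
    Δ * 2 + 2 * p + 2 * p                   ≤⟨ m≤m+n _ (18 * p) ⟩
    Δ * 2 + 2 * p + 2 * p + 18 * p          ≡⟨ lemma Δ p ⟩
    2 * k                                   ≤⟨ 2k≤3b² ⟩
    3 * (b * b)                             ≡⟨ cong (λ x → 3 * (x * x)) (suc-pred b {{>-nonZero b≥1}}) ⟨
    3 * (suc (pred b) * suc (pred b))       ≡⟨ lemma₂ (pred b) ⟩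
    suc (3 * pred b) * suc (pred b) + 2 * suc (pred b)   ≡⟨ cong (λ x → suc (3 * pred b) * x + 2 * x) (suc-pred b {{>-nonZero b≥1}}) ⟩
    suc (3 * pred b) * b + 2 * b            ∎))
    where
    lemma : ∀ d p → d * 2 + 2 * p + 2 * p + 18 * p ≡ 2 * (d + 11 * p)
    lemma = solve-∀
    lemma₂ : ∀ x → 3 * (suc x * suc x) ≡ suc (3 * x) * suc x + 2 * suc x
    lemma₂ = solve-∀

  colours : ℕ
  colours = C + (J * X + (J + (2 * D * 2 + 2)))

  -- 75 = 11 + 18 + 2 + 44: the slack D of the edge colouring, the residues skipped by `base`, the
  -- blocks of slot `s₁`, and 4 D for B. The terms of order N² fit into one further p.
  excess : colours ∸ Δ ≤ 76 * p
  excess = begin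
    C + (J * X + (J + (2 * D * 2 + 2))) ∸ Δ      ≡⟨ cong (λ x → C + (J * x + (J + (2 * D * 2 + 2))) ∸ Δ) X≡b ⟩
    C + (J * b + (J + (2 * D * 2 + 2))) ∸ Δ      ≡⟨ cong (_∸ Δ) (lemma Δ a b) ⟩
    Δ + (75 * p + (8 * a + 2)) ∸ Δ               ≡⟨ m+n∸m≡n Δ _ ⟩
    75 * p + (8 * a + 2)                         ≤⟨ +-monoʳ-≤ (75 * p) (+-monoʳ-≤ (8 * a) (*-monoʳ-≤ 2 a≥1)) ⟩
    75 * p + (8 * a + 2 * a)                     ≡⟨ cong (75 * p +_) (lemma₂ a) ⟩
    75 * p + a * 10                              ≤⟨ +-monoʳ-≤ (75 * p) (*-monoʳ-≤ a (≤-trans (at-least 10) (m≤m*n N a {{>-nonZero a≥1}}))) ⟩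
    75 * p + p                                   ≡⟨ lemma₃ p ⟩
    76 * p                                       ∎
    where
    lemma : ∀ d a b → d + 11 * (a * b) + 6 * a * (3 * b + 1) + (2 * a * b + (2 * a + (2 * (11 * (a * b)) * 2 + 2))) ≡ d + (75 * (a * b) + (8 * a + 2))
    lemma = solve-∀
    lemma₂ : ∀ a → 8 * a + 2 * a ≡ a * 10
    lemma₂ = solve-∀
    lemma₃ : ∀ p → 75 * p + p ≡ 76 * p
    lemma₃ = solve-∀

  bound : Bound Δ colours
  -- The crude estimate of the exponential costs a factor of about 12 in the exponent. It is
  -- affordable because 12 · 76^6 < 139^6: the sixth root of 12 is about 1.51, and 76 times this is
  -- about 115.
  bound = exp-root-bound 76 139 Δ N (≤-trans (≤ᵇ⇒≤ 2 (150 ^ 6) tt) 150⁶≤Δ) lower (subst (λ x → colours ∸ Δ ≤ 76 * x) p≡N⁵ excess)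
    (≤-trans (≤ᵇ⇒≤ (suc (76 ^ 6)) (150 ^ 6) tt) 150⁶≤Δ) (≤ᵇ⇒≤ (suc (6 * (2 * 76 ^ 6))) (139 ^ 6) tt)
    where
    150⁶≤Δ : 150 ^ 6 ≤ Δ
    150⁶≤Δ = ≤-trans (^-monoˡ-≤ 6 N≥150) lower

  nsd-colouring : (G : Graph) → (∀ v → count (adj? G v) ≤ Δ) → HasNSDTotal G colours
  nsd-colouring G degree≤Δ =
    let s , total = EdgeColouring.edge-colouring G k D (λ v → +-monoˡ-≤ D (degree≤Δ v)) k<D²
        inB , few-B , many-B = degenerate-set G D
        -- Here γ = D, which serves both kinds of slot: k - Δ = D colours remain for `s₀`, and more
        -- than D edges to B are available for the others.
        chosen = Selection.choice G Δ k W D β D degree≤Δ s total inB many-B ≤-refl (n≤1+n D) slack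
    in Distinguishing.hasNSDTotal G Δ k W J Y C D degree≤Δ s total inB chosen few-B window<J base<C X²≤C range

theorem10 : Σ ℕ λ Δ₀ → (G : Graph) → Δ₀ ≤ maxDegree G →
    Σ ℕ λ k → Bound (maxDegree G) k × χΣ≤ G k
theorem10 = 150 ^ 6 , λ G 150⁶≤Δ →
  let N , lower , upper = sixth-root (maxDegree G)
      N≥150 = ≮⇒≥ λ N<150 → <⇒≱ upper (≤-trans (^-monoˡ-≤ 6 N<150) 150⁶≤Δ)
      module P = Parameters (maxDegree G) N N≥150 lower upper
  in P.colours , P.bound , P.colours , ≤-refl , P.nsd-colouring G (degree≤maxDegree G)
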